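{- There exists $A \subset \mathbb{N}_0$ with $A^2 + A^2 = \mathbb{N}_0$ and $A(X) = O\!\left(\frac{\sqrt{X}}{(\log X)^{1/4}}\right)$ as $X\to\infty$.
   Context: $\mathbb{N}_0$ is the set of nonnegative integers. $A^2=\{ab: a,b\in A\}$ and $A^2+A^2=\{x+y: x,y\in A^2\}$. $A(X)=|A\cap[1,X]|$. -}

module Defs where

open import Data.List.Base using (applyUpTo; filter; length)
open import Data.Nat.Base using (ℕ; suc; _+_; _*_; _^_; _≤_)
open import Data.Nat.Logarithm using (⌈log₂_⌉)
open import Data.Product.Base using (∃₂; ∃-syntax; _×_)
open import Level using (0ℓ)
open import Relation.Binary.PropositionalEquality.Core using (_≡_)
open import Relation.Unary using (Pred; Decidable; _∈_)

infixl 6 _⊕_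
infix  8 _²

_² : Pred ℕ 0ℓ → Pred ℕ 0ℓ
(A ²) n = ∃₂ λ a b → a ∈ A × b ∈ A × n ≡ a * b

_⊕_ : Pred ℕ 0ℓ → Pred ℕ 0ℓ → Pred ℕ 0ℓ
(B ⊕ C) n = ∃₂ λ x y → x ∈ B × y ∈ C × n ≡ x + y

-- A(X) = |A ∩ [1, X]|: `applyUpTo suc X` is the list 1, …, X, so 0 is never
-- counted.
count : {A : Pred ℕ 0ℓ} → Decidable A → ℕ → ℕ
count A? X = length (filter A? (applyUpTo suc X))

-- f(X) = O(√X / (log X)^{1/4}) as X → ∞, that is, f(X) ≤ c √X / (log X)^{1/4}
-- for some constant c and all large X.  Raising to the fourth power and
-- clearing the denominator gives f(X)⁴ log X ≤ c⁴ X².  The base of the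
-- logarithm and its rounding only affect the constant: for X ≥ 2,
-- log X ≤ ⌈log₂ X⌉ ≤ 2 log₂ X = (2 / log 2) log X.
IsO[√X/[logX]^¼] : (ℕ → ℕ) → Set
IsO[√X/[logX]^¼] f =
  ∃[ C ] ∃[ X₀ ] ∀ X → X₀ ≤ X → f X ^ 4 * ⌈log₂ X ⌉ ≤ C * X ^ 2

module Submission where

-- Each n ≥ 4^38 is served by the stage Q with 38·16^Q ≤ log₄ n < 38·16^(Q+1).  On this range (log n)^{1/4}
-- is of order 2^Q, so a stage may use O(2^k) elements of size about 4^(k + Q) on each of its levels k.  It seeks
-- n = a b + c d with a, c and d taken from explicit sets: multiples of 2^(e + 2Q) for a on level e, short
-- progressions for c, and short intervals for d.  For given n and e, distinct triples (a, c, d) give distinct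
-- integers b = (n - c d) / a, and these b make up a proportion of order 2^(-δ) of all numbers of their size,
-- where δ is the level of b.  Hence a random set of O(2^δ) elements on level δ provides no such b with a small
-- constant probability only, and over the 16^Q possible levels e these probabilities multiply to less than the
-- reciprocal of the number of n to be served.  The random choice is replaced by a greedy one, following the
-- method of conditional expectations.

open import Data.Empty using (⊥; ⊥-elim)
open import Data.List.Base using (List; []; _∷_; _++_; length; concat; filter; applyUpTo)
open import Data.List.Membership.Propositional using (_∈_; find; lose)
open import Data.List.Membership.Propositional.Properties
  using (∈-++⁺ˡ; ∈-++⁺ʳ; ∈-++⁻; ∈-concat⁺′; ∈-concat⁻′; ∈-applyUpTo⁺; ∈-applyUpTo⁻)
open import Data.List.Properties using (length-++; length-applyUpTo)
open import Data.List.Relation.Unary.Any using (Any; here; there; any?)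
open import Data.Nat.Base
open import Data.Nat.Coprimality using (Coprime; coprime?; coprime-Bézout; coprime-divisor)
open import Data.Nat.Divisibility
  using (_∣_; _∣?_; ∣-reflexive; ∣-trans; ∣⇒≤; 0∣⇒≡0; ∣1⇒≡1; ∣m+n∣m⇒∣n; m∣m*n; ∣m⇒∣m*n; ∣n⇒∣m*n)
open import Data.Nat.DivMod using (_/_; _%_; m≡m%n+[m/n]*n; m%n<n)
open import Data.Nat.GCD using (gcd; gcd[m,n]∣m; gcd[m,n]∣n; gcd-greatest; module Bézout)
open import Data.Nat.Logarithm using (⌈log₂_⌉; ⌈log₂⌉-mono-≤; ⌈log₂2^n⌉≡n)
open import Data.Nat.Properties
open import Data.Nat.Tactic.RingSolver using (solve-∀)
open import Data.List.Membership.DecPropositional _≟_ using (_∈?_)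
open import Data.Product.Base using (Σ-syntax; ∃-syntax; _×_; _,_; proj₁; proj₂; map; map₁; map₂)
open import Data.Sum.Base using (_⊎_; inj₁; inj₂; [_,_]′)
open import Data.Unit.Base using (tt)
open import Function.Base using (_∘_; id; _$_)
open import Level using (0ℓ)
open import Relation.Binary.Definitions using (tri<; tri≈; tri>)
open import Relation.Binary.PropositionalEquality
  using (_≡_; refl; sym; trans; cong; cong₂; subst; module ≡-Reasoning)
open import Relation.Nullary using (Dec; yes; no; ¬_; contradiction)
open import Relation.Nullary.Decidable using (¬?; _×-dec_; _⊎-dec_; _→-dec_; toWitness)
open import Relation.Unary using (Pred; Decidable; _≐_; U)
open import Defs

-- The exponent 1/4 comes from a balance. Put h = 16^Q, F = 4^Q and E = 2^e, T = 2^s with s = e + δ.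
-- Level e has E values of a, each of order E^2 F. A product c d of order T^2 F^2 can be split
-- between the levels of c and d in many ways; h of them are used, each with T pairs (c, d). About
-- one triple in a leaves an integer b, which gives about h E T / (E^2 F) = h 2^δ / F values of b
-- among roughly 4^δ F numbers. This is the proportion 2^(-δ) when h = F^2. The union bound, with
-- one attempt for each of h levels e, needs h of order log n. So F is of order (log n)^(1/2), and
-- the elements near 4^k F, being O(2^k) in number, save a factor F^(1/2). The obstacle is to make
-- this count rigorous. All products c d for one n share the leading term w T^2 F^2, with an error
-- too small to allow two different a for one b; c is 1 modulo an even w, which tells the splittings
-- apart; and w is divisible by all m < 13, which makes at least half of the pairs (a, c) coprime,
-- so that b exists for the right d.

-- Indicators and finite sums

𝟙 : {P : Set} → Dec P → ℕ
𝟙 (yes _) = 1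
𝟙 (no _)  = 0

𝟙≤1 : {P : Set} (P? : Dec P) → 𝟙 P? ≤ 1
𝟙≤1 (yes _) = ≤-refl
𝟙≤1 (no _)  = z≤n

𝟙-yes : {P : Set} (P? : Dec P) → P → 𝟙 P? ≡ 1
𝟙-yes (yes _) _ = refl
𝟙-yes (no ¬p) p = contradiction p ¬p

𝟙-no : {P : Set} (P? : Dec P) → ¬ P → 𝟙 P? ≡ 0
𝟙-no (yes p) ¬p = contradiction p ¬p
𝟙-no (no _)  _  = refl

𝟙-pos⇒ : {P : Set} (P? : Dec P) → 0 < 𝟙 P? → P
𝟙-pos⇒ (yes p) _ = p

𝟙-mono : {P R : Set} (P? : Dec P) (R? : Dec R) → (P → R) → 𝟙 P? ≤ 𝟙 R?
𝟙-mono (yes p) R? h = ≤-reflexive (sym (𝟙-yes R? (h p)))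
𝟙-mono (no _)  R? h = z≤n

∑ : ℕ → (ℕ → ℕ) → ℕ
∑ zero    f = 0
∑ (suc n) f = ∑ n f + f n

∑-mono : ∀ n {f g : ℕ → ℕ} → (∀ i → i < n → f i ≤ g i) → ∑ n f ≤ ∑ n g
∑-mono zero    h = z≤n
∑-mono (suc n) h = +-mono-≤ (∑-mono n λ i i<n → h i (m<n⇒m<1+n i<n)) (h n ≤-refl)

∑-cong : ∀ n {f g : ℕ → ℕ} → (∀ i → i < n → f i ≡ g i) → ∑ n f ≡ ∑ n g
∑-cong zero    h = refl
∑-cong (suc n) h = cong₂ _+_ (∑-cong n λ i i<n → h i (m<n⇒m<1+n i<n)) (h n ≤-refl)

∑-const : ∀ n c → ∑ n (λ _ → c) ≡ n * c
∑-const zero    c = refl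
∑-const (suc n) c = trans (cong (_+ c) (∑-const n c)) (+-comm (n * c) c)

∑-+ : ∀ n (f g : ℕ → ℕ) → ∑ n (λ i → f i + g i) ≡ ∑ n f + ∑ n g
∑-+ zero    f g = refl
∑-+ (suc n) f g = trans (cong (_+ (f n + g n)) (∑-+ n f g)) (interchange (∑ n f) (∑ n g) (f n) (g n))
  where
  interchange : ∀ a b c d → a + b + (c + d) ≡ a + c + (b + d)
  interchange = solve-∀

∑-*ˡ : ∀ n c (f : ℕ → ℕ) → ∑ n (λ i → c * f i) ≡ c * ∑ n f
∑-*ˡ zero    c f = sym (*-zeroʳ c)
∑-*ˡ (suc n) c f = trans (cong (_+ c * f n) (∑-*ˡ n c f)) (sym (*-distribˡ-+ c (∑ n f) (f n)))

∑-*ʳ : ∀ n c (f : ℕ → ℕ) → ∑ n (λ i → f i * c) ≡ ∑ n f * c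
∑-*ʳ zero    c f = refl
∑-*ʳ (suc n) c f = trans (cong (_+ f n * c) (∑-*ʳ n c f)) (sym (*-distribʳ-+ c (∑ n f) (f n)))

∑-swap : ∀ m n (f : ℕ → ℕ → ℕ) → ∑ m (λ i → ∑ n (f i)) ≡ ∑ n (λ j → ∑ m (λ i → f i j))
∑-swap zero    n f = sym (trans (∑-const n 0) (*-zeroʳ n))
∑-swap (suc m) n f = trans (cong (_+ ∑ n (f m)) (∑-swap m n f)) (sym (∑-+ n (λ j → ∑ m (λ i → f i j)) (f m)))

∑-split : ∀ m n (f : ℕ → ℕ) → ∑ (m + n) f ≡ ∑ m f + ∑ n (λ j → f (m + j))
∑-split m zero    f = trans (cong (λ k → ∑ k f) (+-identityʳ m)) (sym (+-identityʳ _))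
∑-split m (suc n) f = begin
  ∑ (m + suc n) f                            ≡⟨ cong (λ k → ∑ k f) (+-suc m n) ⟩
  ∑ (m + n) f + f (m + n)                    ≡⟨ cong (_+ f (m + n)) (∑-split m n f) ⟩
  ∑ m f + ∑ n (λ j → f (m + j)) + f (m + n)  ≡⟨ +-assoc (∑ m f) _ _ ⟩
  ∑ m f + ∑ (suc n) (λ j → f (m + j))        ∎
  where open ≡-Reasoning

∑-blocks : ∀ k m (f : ℕ → ℕ) → ∑ (k * m) f ≡ ∑ k (λ b → ∑ m (λ j → f (b * m + j)))
∑-blocks zero    m f = refl
∑-blocks (suc k) m f = begin
  ∑ (m + k * m) f                             ≡⟨ cong (λ t → ∑ t f) (+-comm m (k * m)) ⟩
  ∑ (k * m + m) f                             ≡⟨ ∑-split (k * m) m f ⟩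
  ∑ (k * m) f + ∑ m (λ j → f (k * m + j))     ≡⟨ cong (_+ ∑ m (λ j → f (k * m + j))) (∑-blocks k m f) ⟩
  ∑ (suc k) (λ b → ∑ m (λ j → f (b * m + j))) ∎
  where open ≡-Reasoning

∑-monoˡ : ∀ {m n} (f : ℕ → ℕ) → m ≤ n → ∑ m f ≤ ∑ n f
∑-monoˡ {m} f m≤n with k , refl ← m≤n⇒∃[o]m+o≡n m≤n =
  ≤-trans (m≤m+n _ _) (≤-reflexive (sym (∑-split m k f)))

term≤∑ : ∀ {n i} (f : ℕ → ℕ) → i < n → f i ≤ ∑ n f
term≤∑ {i = i} f i<n = ≤-trans (m≤n+m (f i) (∑ i f)) (∑-monoˡ f i<n)

∑-pos : ∀ n (f : ℕ → ℕ) → 0 < ∑ n f → ∃[ i ] i < n × 0 < f i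
∑-pos (suc n) f pos with f n in eq
... | suc _ = n , ≤-refl , subst (0 <_) (sym eq) z<s
... | zero with i , i<n , fi ← ∑-pos n f (subst (0 <_) (+-identityʳ _) pos) = i , m<n⇒m<1+n i<n , fi

∑-atMostOne : ∀ n (f : ℕ → ℕ) → (∀ i → i < n → f i ≤ 1) →
  (∀ i j → i < n → j < n → 0 < f i → 0 < f j → i ≡ j) → ∑ n f ≤ 1
∑-atMostOne zero    f ≤1 uniq = z≤n
∑-atMostOne (suc n) f ≤1 uniq with f n in eq
... | zero  = subst (_≤ 1) (sym (+-identityʳ _))
  (∑-atMostOne n f (λ i i<n → ≤1 i (m<n⇒m<1+n i<n))
    (λ i j i<n j<n → uniq i j (m<n⇒m<1+n i<n) (m<n⇒m<1+n j<n)))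
... | suc k with ∑ n f in eqs
...   | zero  = subst (_≤ 1) eq (≤1 n ≤-refl)
...   | suc _ with i , i<n , fi ← ∑-pos n f (subst (0 <_) (sym eqs) z<s) =
  contradiction (uniq i n (m<n⇒m<1+n i<n) ≤-refl fi (subst (0 <_) (sym eq) z<s)) (<⇒≢ i<n)

∑-large⇒term : ∀ n (f : ℕ → ℕ) c → 0 < n → n * c ≤ ∑ n f → ∃[ i ] i < n × c ≤ f i
∑-large⇒term (suc n) f c _ h with c ≤? f n
... | yes c≤ = n , ≤-refl , c≤
∑-large⇒term (suc zero)    f c _ h | no c≰ = contradiction (subst (_≤ f 0) (+-identityʳ c) h) c≰
∑-large⇒term (suc (suc n)) f c _ h | no c≰
  with i , i<n , fi ← ∑-large⇒term (suc n) f c z<s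
         (+-cancelˡ-≤ c _ _ (≤-trans h (≤-trans (+-monoʳ-≤ (∑ (suc n) f) (<⇒≤ (≰⇒> c≰))) (≤-reflexive (+-comm _ c)))))
  = i , m<n⇒m<1+n i<n , fi

-- Each block of `m` consecutive indices holds at most one nonzero term, and `suc (n / m)` blocks
-- cover the range; the summand `+ m` pays for the last block.
∑-sparse : ∀ n m .{{_ : NonZero m}} (f : ℕ → ℕ) → (∀ i → f i ≤ 1) →
  (∀ i j → i < j → 0 < f i → 0 < f j → i + m ≤ j) → m * ∑ n f ≤ n + m
∑-sparse n m f ≤1 gap = begin
  m * ∑ n f              ≤⟨ *-monoʳ-≤ m (∑-monoˡ f n≤km) ⟩
  m * ∑ (k * m) f        ≡⟨ cong (m *_) (∑-blocks k m f) ⟩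
  m * ∑ k (λ b → ∑ m (λ j → f (b * m + j))) ≤⟨ *-monoʳ-≤ m (∑-mono k λ b _ → block b) ⟩
  m * ∑ k (λ _ → 1)      ≡⟨ cong (m *_) (trans (∑-const k 1) (*-identityʳ k)) ⟩
  m * suc (n / m)        ≡⟨ *-suc m (n / m) ⟩
  m + m * (n / m)        ≡⟨ +-comm m _ ⟩
  m * (n / m) + m        ≤⟨ +-monoˡ-≤ m (≤-trans (≤-reflexive (*-comm m (n / m)))
                              (≤-trans (m≤n+m _ (n % m)) (≤-reflexive (sym (m≡m%n+[m/n]*n n m))))) ⟩
  n + m                  ∎
  where
  open ≤-Reasoning
  k = suc (n / m)
  n≤km : n ≤ k * m
  n≤km = ≤-trans (≤-reflexive (m≡m%n+[m/n]*n n m)) (+-monoˡ-≤ (n / m * m) (<⇒≤ (m%n<n n m)))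
  close : ∀ b i j → j < m → i < j → 0 < f (b * m + i) → 0 < f (b * m + j) → ⊥
  close b i j j<m i<j fi fj = <⇒≱ (+-monoʳ-< (b * m) j<m)
    (≤-trans (≤-trans (m≤m+n (b * m + m) i) (≤-reflexive (shuffle (b * m) m i)))
      (gap (b * m + i) (b * m + j) (+-monoʳ-< (b * m) i<j) fi fj))
    where
    shuffle : ∀ x y z → x + y + z ≡ x + z + y
    shuffle = solve-∀
  block : ∀ b → ∑ m (λ j → f (b * m + j)) ≤ 1
  block b = ∑-atMostOne m _ (λ j _ → ≤1 (b * m + j)) uniq
    where
    uniq : ∀ i j → i < m → j < m → 0 < f (b * m + i) → 0 < f (b * m + j) → i ≡ j
    uniq i j i<m j<m fi fj with <-cmp i j
    ... | tri< i<j _ _ = ⊥-elim (close b i j j<m i<j fi fj)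
    ... | tri≈ _ i≡j _ = i≡j
    ... | tri> _ _ j<i = ⊥-elim (close b j i i<m j<i fj fi)

-- Linear congruences with nonnegative solutions

-- `c` is invertible modulo `a`. The bound `c * a ≤ r` keeps r - c y nonnegative, so that the
-- quotient `β` is a natural number.
linear-congruence : ∀ a c r .{{_ : NonZero a}} → Coprime a c → c * a ≤ r →
  ∃[ y ] y < a × ∃[ β ] r ≡ a * β + c * y
linear-congruence a c r cop ca≤r = solve (coprime-Bézout cop)
  where
  quotient : ∀ p q s → s ≤ r → r + a * p ≡ s + a * q → ∃[ β ] r ≡ a * β + s
  quotient p q s s≤r eq with k , refl ← m≤n⇒∃[o]m+o≡n {p} {q}
      (*-cancelˡ-≤ a (+-cancelˡ-≤ r _ _ (≤-trans (≤-reflexive eq) (+-monoˡ-≤ (a * q) s≤r))))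
    = k , +-cancelʳ-≡ (a * p) r (a * k + s) (trans eq (alg s a p k))
    where
    alg : ∀ s a p k → s + a * (p + k) ≡ a * k + s + a * p
    alg = solve-∀

  finish : ∀ t p q → r + a * p ≡ c * t + a * q → ∃[ y ] y < a × ∃[ β ] r ≡ a * β + c * y
  finish t p q eq = y , m%n<n t a ,
    quotient p (c * (t / a) + q) (c * y) (≤-trans (*-monoʳ-≤ c (<⇒≤ (m%n<n t a))) ca≤r)
      (trans eq (trans (cong (λ u → c * u + a * q) (m≡m%n+[m/n]*n t a)) (alg c y (t / a) a q)))
    where
    y = t % a
    alg : ∀ c y k a q → c * (y + k * a) + a * q ≡ c * y + a * (c * k + q)
    alg = solve-∀

  solve : Bézout.Identity 1 a c → ∃[ y ] y < a × ∃[ β ] r ≡ a * β + c * y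
  solve (Bézout.-+ u v eq) = finish (r * v) (r * u) 0
    (trans (alg₁ r a u) (trans (cong (r *_) eq) (alg₂ r v c a)))
    where
    alg₁ : ∀ r a u → r + a * (r * u) ≡ r * (1 + u * a)
    alg₁ = solve-∀
    alg₂ : ∀ r v c a → r * (v * c) ≡ c * (r * v) + a * 0
    alg₂ = solve-∀
  -- Here `v` inverts -c modulo `a`; the factor `k`, which is -1 modulo a = 1 + k, repairs the sign.
  solve (Bézout.+- u v eq) with k , refl ← m≤n⇒∃[o]m+o≡n (>-nonZero⁻¹ a) =
    finish (r * v * k) (r * v * c) (r * u) (trans (alg₁ r k v c) (trans (cong (λ t → c * (r * v * k) + r * t) eq) (alg₂ c r v k u)))
    where
    alg₁ : ∀ r k v c → r + (1 + k) * (r * v * c) ≡ c * (r * v * k) + r * (1 + v * c)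
    alg₁ = solve-∀
    alg₂ : ∀ c r v k u → c * (r * v * k) + r * (u * (1 + k)) ≡ c * (r * v * k) + (1 + k) * (r * u)
    alg₂ = solve-∀

-- At least half of the pairs are coprime

private
  -- Telescoping with denominators cleared: B / ((k + j)(k + j + 1)) is B / (k + j) - B / (k + j +
  -- 1), so the sum is at most B / k - B / (k + M).
  tail-sum : ∀ M k B (t : ℕ → ℕ) → 1 ≤ k →
    (∀ j → j < M → (k + j) * suc (k + j) * t j ≤ B) → k * ((k + M) * ∑ M t) ≤ B * M
  tail-sum zero    k B t k≥1 h = ≤-reflexive (alg k B)
    where
    alg : ∀ k B → k * ((k + 0) * 0) ≡ B * 0
    alg = solve-∀
  tail-sum (suc M) k@(suc _) B t k≥1 h = *-cancelˡ-≤ (k + M) $ begin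
    (k + M) * (k * ((k + suc M) * (∑ M t + t M)))
      ≡⟨ alg₁ k M (∑ M t) (t M) ⟩
    suc (k + M) * (k * ((k + M) * ∑ M t)) + k * ((k + M) * suc (k + M) * t M)
      ≤⟨ +-mono-≤ (*-monoʳ-≤ (suc (k + M)) (tail-sum M k B t k≥1 λ j j<M → h j (m<n⇒m<1+n j<M)))
                  (*-monoʳ-≤ k (h M ≤-refl)) ⟩
    suc (k + M) * (B * M) + k * B
      ≡⟨ alg₂ k M B ⟩
    (k + M) * (B * suc M) ∎
    where
    open ≤-Reasoning
    alg₁ : ∀ k M s t → (k + M) * (k * ((k + suc M) * (s + t)))
         ≡ suc (k + M) * (k * ((k + M) * s)) + k * ((k + M) * suc (k + M) * t)
    alg₁ = solve-∀
    alg₂ : ∀ k M B → suc (k + M) * (B * M) + k * B ≡ (k + M) * (B * suc M)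
    alg₂ = solve-∀

-- `m` divides `v` times the distance of two hits, hence the distance. Coprimality is asked at hits
-- only, because for the progression `c` it is deduced from the hit itself.
∣-sparse : ∀ {m v} (g : ℕ → ℕ) → (∀ i k → g (i + k) ≡ g i + v * k) →
  (∀ i → m ∣ g i → Coprime m v) → ∀ {i j} → i < j → m ∣ g i → m ∣ g j → i + m ≤ j
∣-sparse {m} {v} g step cop {i} i<j m∣gi m∣gj with k , refl ← m≤n⇒∃[o]m+o≡n i<j =
  ≤-trans (+-monoʳ-≤ i (∣⇒≤ (coprime-divisor (cop i m∣gi)
    (∣m+n∣m⇒∣n (subst (m ∣_) (trans (cong g (sym (+-suc i k))) (step i (suc k))) m∣gj) m∣gi))))
    (≤-reflexive (+-suc i k))

-- A common divisor m > 1 of E + z and w (B + x) + 1 is at least 13, and the sum of 6 / m² over m ≥ 13 is at most 1/2.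
module _ (w E P B : ℕ) .{{_ : NonZero E}} (w-divisible : ∀ m → 0 < m → m < 13 → m ∣ w) (2E≤P : 2 * E ≤ P) where

  private
    c : ℕ → ℕ
    c x = w * (B + x) + 1

    u v : ℕ → ℕ → ℕ
    u j z = 𝟙 (13 + j ∣? E + z)
    v j x = 𝟙 (13 + j ∣? c x)

    coprime-w : ∀ {m} x → m ∣ c x → Coprime m w
    coprime-w x m∣c (d∣m , d∣w) = ∣1⇒≡1 (∣m+n∣m⇒∣n (∣-trans d∣m m∣c) (∣m⇒∣m*n (B + x) d∣w))

    -- A pair that is not coprime is charged to its gcd. That gcd divides E + z < 2E, whence the
    -- range of `j`.
    cover : ∀ z x → z < E → 1 ≤ 𝟙 (coprime? (E + z) (c x)) + ∑ (2 * E) (λ j → u j z * v j x)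
    cover z x z<E with coprime? (E + z) (c x)
    ... | yes _ = s≤s z≤n
    ... | no ¬cop = ≤-trans (≤-reflexive (sym uv≡1)) (term≤∑ (λ j → u j z * v j x) j<2E)
      where
      g = gcd (E + z) (c x)
      g∣z : g ∣ E + z
      g∣z = gcd[m,n]∣m (E + z) (c x)
      g∣c : g ∣ c x
      g∣c = gcd[m,n]∣n (E + z) (c x)
      instance
        E+z≢0 : NonZero (E + z)
        E+z≢0 = >-nonZero (≤-trans (>-nonZero⁻¹ E) (m≤m+n E z))
      g>0 : 0 < g
      g>0 = n≢0⇒n>0 λ g≡0 → ≢-nonZero⁻¹ (E + z) (0∣⇒≡0 (subst (_∣ E + z) g≡0 g∣z))
      13≤g : 13 ≤ g
      13≤g with 13 ≤? g
      ... | yes p = p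
      ... | no ¬p = ⊥-elim (¬cop λ {d} (d∣z , d∣c) → coprime-w x d∣c
              (∣-reflexive refl , ∣-trans (gcd-greatest d∣z d∣c) (w-divisible g g>0 (≰⇒> ¬p))))
      j = g ∸ 13
      g≡ : 13 + j ≡ g
      g≡ = m+[n∸m]≡n 13≤g
      j<2E : j < 2 * E
      j<2E = begin-strict
        j     ≤⟨ m∸n≤m g 13 ⟩
        g     ≤⟨ ∣⇒≤ g∣z ⟩
        E + z <⟨ +-monoʳ-< E z<E ⟩
        E + E ≡⟨ cong (E +_) (sym (+-identityʳ E)) ⟩
        2 * E ∎
        where open ≤-Reasoning
      uv≡1 : u j z * v j x ≡ 1
      uv≡1 = cong₂ _*_ (𝟙-yes (13 + j ∣? E + z) (subst (_∣ E + z) (sym g≡) g∣z))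
                       (𝟙-yes (13 + j ∣? c x) (subst (_∣ c x) (sym g≡) g∣c))

    separate : ∑ E (λ z → ∑ P λ x → ∑ (2 * E) λ j → u j z * v j x)
             ≡ ∑ (2 * E) (λ j → ∑ E (u j) * ∑ P (v j))
    separate = begin
      ∑ E (λ z → ∑ P λ x → ∑ (2 * E) λ j → u j z * v j x)
        ≡⟨ ∑-cong E (λ z _ → ∑-swap P (2 * E) (λ x j → u j z * v j x)) ⟩
      ∑ E (λ z → ∑ (2 * E) λ j → ∑ P λ x → u j z * v j x)
        ≡⟨ ∑-swap E (2 * E) (λ z j → ∑ P λ x → u j z * v j x) ⟩
      ∑ (2 * E) (λ j → ∑ E λ z → ∑ P λ x → u j z * v j x)
        ≡⟨ ∑-cong (2 * E) (λ j _ → trans (∑-cong E λ z _ → ∑-*ˡ P (u j z) (v j)) (∑-*ʳ E (∑ P (v j)) (u j))) ⟩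
      ∑ (2 * E) (λ j → ∑ E (u j) * ∑ P (v j)) ∎
      where open ≡-Reasoning

    -- With m = 13 + j there are at most (E + m) / m values of z and (P + m) / m values of x, and m
    -- ≤ 2E ≤ P bounds the product by 3E · 2P / m^2. A larger m divides no E + z. One factor m is
    -- lowered to 12 + j so that the bounds telescope.
    few : ∀ j → (12 + j) * (13 + j) * (∑ E (u j) * ∑ P (v j)) ≤ 6 * (E * P)
    few j with 13 + j ≤? 2 * E
    ... | yes m≤2E = begin
      (12 + j) * (13 + j) * (∑ E (u j) * ∑ P (v j))
        ≤⟨ *-monoˡ-≤ (∑ E (u j) * ∑ P (v j)) (*-monoˡ-≤ (13 + j) (n≤1+n (12 + j))) ⟩
      (13 + j) * (13 + j) * (∑ E (u j) * ∑ P (v j))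
        ≡⟨ alg₁ (13 + j) (∑ E (u j)) (∑ P (v j)) ⟩
      ((13 + j) * ∑ E (u j)) * ((13 + j) * ∑ P (v j))
        ≤⟨ *-mono-≤
            (∑-sparse E (13 + j) (u j) (λ z → 𝟙≤1 (13 + j ∣? E + z)) λ z z′ z<z′ p q →
               ∣-sparse {v = 1} (E +_) (λ z k → trans (sym (+-assoc E z k)) (cong (E + z +_) (sym (*-identityˡ k))))
                 (λ _ _ (_ , d∣1) → ∣1⇒≡1 d∣1) z<z′ (𝟙-pos⇒ (_ ∣? _) p) (𝟙-pos⇒ (_ ∣? _) q))
            (∑-sparse P (13 + j) (v j) (λ x → 𝟙≤1 (13 + j ∣? c x)) λ x x′ x<x′ p q →
               ∣-sparse {v = w} c (alg₃ w B) coprime-w x<x′ (𝟙-pos⇒ (_ ∣? _) p) (𝟙-pos⇒ (_ ∣? _) q)) ⟩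
      (E + (13 + j)) * (P + (13 + j))
        ≤⟨ *-mono-≤ (+-monoʳ-≤ E m≤2E) (+-monoʳ-≤ P (≤-trans m≤2E 2E≤P)) ⟩
      (E + 2 * E) * (P + P) ≡⟨ alg₂ E P ⟩
      6 * (E * P) ∎
      where
      open ≤-Reasoning
      alg₁ : ∀ m s t → m * m * (s * t) ≡ (m * s) * (m * t)
      alg₁ = solve-∀
      alg₂ : ∀ E P → (E + 2 * E) * (P + P) ≡ 6 * (E * P)
      alg₂ = solve-∀
      alg₃ : ∀ w B i k → w * (B + (i + k)) + 1 ≡ w * (B + i) + 1 + w * k
      alg₃ = solve-∀
    ... | no m≰2E = ≤-trans (≤-reflexive (trans (cong (λ s → (12 + j) * (13 + j) * (s * ∑ P (v j))) none)
                                                (*-zeroʳ ((12 + j) * (13 + j))))) z≤n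
      where
      none : ∑ E (u j) ≡ 0
      none = trans (∑-cong E λ z z<E → 𝟙-no (13 + j ∣? E + z) λ m∣ → m≰2E (≤-trans (∣⇒≤ {{>-nonZero (≤-trans (>-nonZero⁻¹ E) (m≤m+n E z))}} m∣)
               (≤-trans (+-monoʳ-≤ E (<⇒≤ z<E)) (≤-reflexive (cong (E +_) (sym (+-identityʳ E)))))))
             (trans (∑-const E 0) (*-zeroʳ E))

  coprime-pairs : E * P ≤ 2 * ∑ E (λ z → ∑ P λ x → 𝟙 (coprime? (E + z) (c x)))
  coprime-pairs = +-cancelʳ-≤ (E * P) _ _ $ begin
    E * P + E * P       ≡⟨ alg₁ (E * P) ⟩
    2 * (E * P)         ≤⟨ *-monoʳ-≤ 2 total ⟩
    2 * (C + S)         ≡⟨ *-distribˡ-+ 2 C S ⟩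
    2 * C + 2 * S       ≤⟨ +-monoʳ-≤ (2 * C) half ⟩
    2 * C + E * P       ∎
    where
    open ≤-Reasoning
    C = ∑ E (λ z → ∑ P λ x → 𝟙 (coprime? (E + z) (c x)))
    S = ∑ (2 * E) (λ j → ∑ E (u j) * ∑ P (v j))
    alg₁ : ∀ s → s + s ≡ 2 * s
    alg₁ = solve-∀
    alg₂ : ∀ M S → 6 * ((12 + M) * (2 * S)) ≡ 12 * ((12 + M) * S)
    alg₂ = solve-∀
    alg₃ : ∀ M t → 6 * t * (12 + M) ≡ 6 * ((12 + M) * t)
    alg₃ = solve-∀
    total : E * P ≤ C + S
    total = begin
      E * P
        ≡⟨ sym (trans (∑-const E (P * 1)) (cong (E *_) (*-identityʳ P))) ⟩
      ∑ E (λ z → P * 1)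
        ≤⟨ ∑-mono E (λ z z<E → ≤-trans (≤-reflexive (sym (∑-const P 1))) (∑-mono P λ x _ → cover z x z<E)) ⟩
      ∑ E (λ z → ∑ P λ x → 𝟙 (coprime? (E + z) (c x)) + ∑ (2 * E) (λ j → u j z * v j x))
        ≡⟨ ∑-cong E (λ z _ → ∑-+ P (λ x → 𝟙 (coprime? (E + z) (c x))) _) ⟩
      ∑ E (λ z → ∑ P (λ x → 𝟙 (coprime? (E + z) (c x))) + ∑ P (λ x → ∑ (2 * E) (λ j → u j z * v j x)))
        ≡⟨ ∑-+ E (λ z → ∑ P (λ x → 𝟙 (coprime? (E + z) (c x)))) _ ⟩
      C + ∑ E (λ z → ∑ P λ x → ∑ (2 * E) λ j → u j z * v j x)
        ≡⟨ cong (C +_) separate ⟩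
      C + S ∎
    half : 2 * S ≤ E * P
    half = *-cancelˡ-≤ (12 + 2 * E) $ *-cancelˡ-≤ 6 $ begin
      6 * ((12 + 2 * E) * (2 * S))   ≡⟨ alg₂ (2 * E) S ⟩
      -- The tail from 13 on amounts to at most 6/12 of E P. This is why `w` has to take care of the
      -- divisors below 13.
      12 * ((12 + 2 * E) * S)        ≤⟨ tail-sum (2 * E) 12 (6 * (E * P)) _ (s≤s z≤n) (λ j _ → few j) ⟩
      6 * (E * P) * (2 * E)          ≤⟨ *-monoʳ-≤ (6 * (E * P)) (m≤n+m (2 * E) 12) ⟩
      6 * (E * P) * (12 + 2 * E)     ≡⟨ alg₃ (2 * E) (E * P) ⟩
      6 * ((12 + 2 * E) * (E * P))   ∎

-- Repeated loss of a fixed fraction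

bernoulli : ∀ a k → a ^ k * (a + k) ≤ a * suc a ^ k
bernoulli a zero    = ≤-reflexive (alg a)
  where
  alg : ∀ a → 1 * (a + 0) ≡ a * 1
  alg = solve-∀
bernoulli a (suc k) = begin
  a * a ^ k * (a + suc k)           ≤⟨ m≤m+n _ (a ^ k * k) ⟩
  a * a ^ k * (a + suc k) + a ^ k * k ≡⟨ alg₁ a (a ^ k) k ⟩
  suc a * (a ^ k * (a + k))         ≤⟨ *-monoʳ-≤ (suc a) (bernoulli a k) ⟩
  suc a * (a * suc a ^ k)           ≡⟨ alg₂ a (suc a ^ k) ⟩
  a * (suc a * suc a ^ k)           ∎
  where
  open ≤-Reasoning
  alg₁ : ∀ a p k → a * p * (a + suc k) + p * k ≡ suc a * (p * (a + k))
  alg₁ = solve-∀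
  alg₂ : ∀ a p → suc a * (a * p) ≡ a * (suc a * p)
  alg₂ = solve-∀

-- Losing the fraction 1 / (a + 1) in each of a + 1 rounds at least halves a quantity.
2*a^[1+a]≤[1+a]^[1+a] : ∀ a .{{_ : NonZero a}} → 2 * a ^ suc a ≤ suc a ^ suc a
2*a^[1+a]≤[1+a]^[1+a] a = *-cancelˡ-≤ a $ begin
  a * (2 * a ^ suc a)       ≡⟨ alg a (a ^ suc a) ⟩
  a ^ suc a * (a + a)       ≤⟨ *-monoʳ-≤ (a ^ suc a) (+-monoʳ-≤ a (n≤1+n a)) ⟩
  a ^ suc a * (a + suc a)   ≤⟨ bernoulli a (suc a) ⟩
  a * suc a ^ suc a         ∎
  where
  open ≤-Reasoning
  alg : ∀ a p → a * (2 * p) ≡ p * (a + a)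
  alg = solve-∀

^-distribʳ-* : ∀ k m n → (m * n) ^ k ≡ m ^ k * n ^ k
^-distribʳ-* zero    m n = refl
^-distribʳ-* (suc k) m n = trans (cong (m * n *_) (^-distribʳ-* k m n)) (alg m n (m ^ k) (n ^ k))
  where
  alg : ∀ m n p q → m * n * (p * q) ≡ m * p * (n * q)
  alg = solve-∀

2^D*a^≤ : ∀ a D .{{_ : NonZero a}} → 2 ^ D * a ^ (suc a * D) ≤ suc a ^ (suc a * D)
2^D*a^≤ a D = begin
  2 ^ D * a ^ (suc a * D)     ≡⟨ cong (2 ^ D *_) (sym (^-*-assoc a (suc a) D)) ⟩
  2 ^ D * (a ^ suc a) ^ D     ≡⟨ sym (^-distribʳ-* D 2 (a ^ suc a)) ⟩
  (2 * a ^ suc a) ^ D         ≤⟨ ^-monoˡ-≤ D (2*a^[1+a]≤[1+a]^[1+a] a) ⟩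
  (suc a ^ suc a) ^ D         ≡⟨ ^-*-assoc (suc a) (suc a) D ⟩
  suc a ^ (suc a * D)         ∎
  where open ≤-Reasoning

-- Greedy covering by conditional expectations

module _ (N S a : ℕ) (S>0 : 0 < S) {Cov : ℕ → ℕ → Set} (cov? : ∀ n b → Dec (Cov n b)) where

  Dense : (ℕ → ℕ) → Set
  Dense v = ∀ n → n < N → 0 < v n → S ≤ suc a * ∑ S (λ b → 𝟙 (cov? n b))

  uncovered : List ℕ → ℕ → ℕ
  uncovered B n = 𝟙 (¬? (any? (cov? n) B))

  -- Averaging: a uniformly random b < S covers each `n` of positive weight with probability at
  -- least 1 / (a + 1), so some `b` covers that share of the total weight.
  pick : ∀ v → Dense v → ∃[ b ] ∑ N v ≤ suc a * ∑ N (λ n → v n * 𝟙 (cov? n b))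
  pick v dense = map₂ proj₂
    (∑-large⇒term S (λ b → suc a * ∑ N (λ n → v n * 𝟙 (cov? n b))) (∑ N v) S>0 average)
    where
    open ≤-Reasoning
    pointwise : ∀ n → n < N → S * v n ≤ suc a * (v n * ∑ S (λ b → 𝟙 (cov? n b)))
    pointwise n n<N with v n in eq
    ... | zero  = ≤-trans (≤-reflexive (*-zeroʳ S)) z≤n
    ... | suc k = begin
      S * suc k                                            ≤⟨ *-monoˡ-≤ (suc k) (dense n n<N (subst (0 <_) (sym eq) z<s)) ⟩
      suc a * ∑ S (λ b → 𝟙 (cov? n b)) * suc k             ≡⟨ alg (suc a) (∑ S (λ b → 𝟙 (cov? n b))) (suc k) ⟩
      suc a * (suc k * ∑ S (λ b → 𝟙 (cov? n b)))           ∎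
      where
      alg : ∀ x y z → x * y * z ≡ x * (z * y)
      alg = solve-∀
    average : S * ∑ N v ≤ ∑ S (λ b → suc a * ∑ N (λ n → v n * 𝟙 (cov? n b)))
    average = begin
      S * ∑ N v                                                 ≡⟨ sym (∑-*ˡ N S v) ⟩
      ∑ N (λ n → S * v n)                                       ≤⟨ ∑-mono N pointwise ⟩
      ∑ N (λ n → suc a * (v n * ∑ S (λ b → 𝟙 (cov? n b))))      ≡⟨ ∑-*ˡ N (suc a) _ ⟩
      suc a * ∑ N (λ n → v n * ∑ S (λ b → 𝟙 (cov? n b)))        ≡⟨ cong (suc a *_) (∑-cong N λ n _ → sym (∑-*ˡ S (v n) _)) ⟩
      suc a * ∑ N (λ n → ∑ S (λ b → v n * 𝟙 (cov? n b)))        ≡⟨ cong (suc a *_) (∑-swap N S (λ n b → v n * 𝟙 (cov? n b))) ⟩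
      suc a * ∑ S (λ b → ∑ N (λ n → v n * 𝟙 (cov? n b)))        ≡⟨ sym (∑-*ˡ S (suc a) _) ⟩
      ∑ S (λ b → suc a * ∑ N (λ n → v n * 𝟙 (cov? n b)))        ∎

  -- Covered numbers get weight 0, so `Dense`, which speaks of positive weights only, persists from
  -- one pick to the next.
  picks : ∀ r v → Dense v → ∃[ B ] length B ≡ r ×
    suc a ^ r * ∑ N (λ n → v n * uncovered B n) ≤ a ^ r * ∑ N v
  picks zero v dense = [] , refl , *-monoʳ-≤ 1 (∑-mono N λ n _ →
    ≤-trans (*-monoʳ-≤ (v n) (𝟙≤1 (¬? (any? (cov? n) [])))) (≤-reflexive (*-identityʳ (v n))))
  picks (suc r) v dense
    with b , h ← pick v dense
    with B , refl , ih ← picks r (λ n → v n * 𝟙 (¬? (cov? n b)))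
           (λ n n<N pos → dense n n<N (n≢0⇒n>0 λ v≡0 → <⇒≢ pos (sym (cong (_* 𝟙 (¬? (cov? n b))) v≡0))))
    = b ∷ B , refl , (begin
      suc a ^ suc r * ∑ N (λ n → v n * uncovered (b ∷ B) n)
        ≤⟨ *-monoʳ-≤ (suc a ^ suc r) (∑-mono N λ n _ → ≤-trans (*-monoʳ-≤ (v n) (split n)) (≤-reflexive (sym (*-assoc (v n) _ _)))) ⟩
      suc a ^ suc r * ∑ N (λ n → v n * 𝟙 (¬? (cov? n b)) * uncovered B n)
        ≡⟨ *-assoc (suc a) (suc a ^ r) _ ⟩
      suc a * (suc a ^ r * ∑ N (λ n → v n * 𝟙 (¬? (cov? n b)) * uncovered B n))
        ≤⟨ *-monoʳ-≤ (suc a) ih ⟩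
      suc a * (a ^ r * left)
        ≡⟨ alg (suc a) (a ^ r) left ⟩
      a ^ r * (suc a * left)
        ≤⟨ *-monoʳ-≤ (a ^ r) shrink ⟩
      a ^ r * (a * ∑ N v)
        ≡⟨ alg′ (a ^ r) a (∑ N v) ⟩
      a ^ suc r * ∑ N v ∎)
    where
    open ≤-Reasoning
    alg : ∀ x y z → x * (y * z) ≡ y * (x * z)
    alg = solve-∀
    alg′ : ∀ x y z → x * (y * z) ≡ y * x * z
    alg′ = solve-∀
    left = ∑ N (λ n → v n * 𝟙 (¬? (cov? n b)))
    C = ∑ N (λ n → v n * 𝟙 (cov? n b))
    split : ∀ n → uncovered (b ∷ B) n ≤ 𝟙 (¬? (cov? n b)) * uncovered B n
    split n with cov? n b | any? (cov? n) B
    ... | yes _ | yes _ = z≤n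
    ... | yes _ | no _  = z≤n
    ... | no _  | yes _ = z≤n
    ... | no _  | no _  = ≤-refl
    complement : ∀ n → v n * 𝟙 (¬? (cov? n b)) + v n * 𝟙 (cov? n b) ≡ v n
    complement n with cov? n b
    ... | yes _ = trans (cong (_+ v n * 1) (*-zeroʳ (v n))) (*-identityʳ (v n))
    ... | no _  = trans (cong (v n * 1 +_) (*-zeroʳ (v n))) (trans (+-identityʳ _) (*-identityʳ (v n)))
    left+C : left + C ≡ ∑ N v
    left+C = trans (sym (∑-+ N _ _)) (∑-cong N λ n _ → complement n)
    shrink : suc a * left ≤ a * ∑ N v
    shrink = +-cancelʳ-≤ (∑ N v) _ _ (begin
      suc a * left + ∑ N v        ≤⟨ +-monoʳ-≤ (suc a * left) h ⟩
      suc a * left + suc a * C    ≡⟨ sym (*-distribˡ-+ (suc a) left C) ⟩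
      suc a * (left + C)          ≡⟨ cong (suc a *_) left+C ⟩
      suc a * ∑ N v            ≡⟨ +-comm (∑ N v) (a * ∑ N v) ⟩
      a * ∑ N v + ∑ N v        ∎)

  reduce : ∀ D v .{{_ : NonZero a}} → Dense v →
    ∃[ B ] length B ≡ suc a * D × 2 ^ D * ∑ N (λ n → v n * uncovered B n) ≤ ∑ N v
  reduce D v dense with B , len , h ← picks (suc a * D) v dense =
    B , len , *-cancelˡ-≤ (a ^ r) {{m^n≢0 a r}} (begin
      a ^ r * (2 ^ D * left)   ≡⟨ alg (a ^ r) (2 ^ D) left ⟩
      2 ^ D * a ^ r * left     ≤⟨ *-monoˡ-≤ left (2^D*a^≤ a D) ⟩
      suc a ^ r * left         ≤⟨ h ⟩
      a ^ r * ∑ N v         ∎)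
    where
    open ≤-Reasoning
    r = suc a * D
    left = ∑ N (λ n → v n * uncovered B n)
    alg : ∀ x y z → x * (y * z) ≡ y * x * z
    alg = solve-∀

-- Conditional expectations: a number not yet covered carries weight 2^D for each stage at which it was active.
module Cover (N D : ℕ) (S a : ℕ → ℕ)
  (S>0 : ∀ δ → 0 < S δ) (a≢0 : ∀ δ → NonZero (a δ))
  {Cov : ℕ → ℕ → ℕ → Set} (cov? : ∀ δ n b → Dec (Cov δ n b))
  {Active : ℕ → ℕ → Set} (active? : ∀ δ n → Dec (Active δ n))
  (dense : ∀ δ n → n < N → Active δ n → S δ ≤ suc (a δ) * ∑ (S δ) (λ b → 𝟙 (cov? δ n b)))
  where

  private
    restrict : ℕ → (ℕ → ℕ) → ℕ → ℕ
    restrict δ v n = v n * 𝟙 (active? δ n)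

    choose : ∀ δ v → _
    choose δ v = reduce N (S δ) (a δ) (S>0 δ) (cov? δ) D (restrict δ v) {{a≢0 δ}}
      (λ n n<N pos → dense δ n n<N (𝟙-pos⇒ (active? δ n) (n≢0⇒n>0 λ eq →
        <⇒≢ pos (sym (trans (cong (v n *_) eq) (*-zeroʳ (v n)))))))

    -- The factor `2 ^ D` spends exactly the gain of `reduce`, so the total weight never exceeds
    -- `N`. An active number that gets covered drops to weight 0 for good.
    weight : ℕ → ℕ → ℕ
    weight zero    n = 1
    weight (suc δ) n = 2 ^ D * (restrict δ (weight δ) n * 𝟙 (¬? (any? (cov? δ n) (proj₁ (choose δ (weight δ))))))
                       + weight δ n * 𝟙 (¬? (active? δ n))

  family : ℕ → List ℕ
  family δ = proj₁ (choose δ (weight δ))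

  length-family : ∀ δ → length (family δ) ≡ suc (a δ) * D
  length-family δ = proj₁ (proj₂ (choose δ (weight δ)))

  private
    total : ∀ δ → ∑ N (weight δ) ≤ N
    total zero    = ≤-reflexive (trans (∑-const N 1) (*-identityʳ N))
    total (suc δ) = begin
      ∑ N (weight (suc δ))
        ≡⟨ trans (∑-+ N _ _) (cong (_+ ∑ N (λ n → weight δ n * 𝟙 (¬? (active? δ n)))) (∑-*ˡ N (2 ^ D) _)) ⟩
      2 ^ D * ∑ N (λ n → restrict δ (weight δ) n * 𝟙 (¬? (any? (cov? δ n) (family δ)))) + ∑ N (λ n → weight δ n * 𝟙 (¬? (active? δ n)))
        ≤⟨ +-monoˡ-≤ _ (proj₂ (proj₂ (choose δ (weight δ)))) ⟩
      ∑ N (restrict δ (weight δ)) + ∑ N (λ n → weight δ n * 𝟙 (¬? (active? δ n)))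
        ≡⟨ sym (∑-+ N _ _) ⟩
      ∑ N (λ n → weight δ n * 𝟙 (active? δ n) + weight δ n * 𝟙 (¬? (active? δ n)))
        ≡⟨ ∑-cong N (λ n _ → complement n) ⟩
      ∑ N (weight δ)
        ≤⟨ total δ ⟩
      N ∎
      where
      open ≤-Reasoning
      complement : ∀ n → weight δ n * 𝟙 (active? δ n) + weight δ n * 𝟙 (¬? (active? δ n)) ≡ weight δ n
      complement n with active? δ n
      ... | yes _ = trans (cong (weight δ n * 1 +_) (*-zeroʳ (weight δ n))) (trans (+-identityʳ _) (*-identityʳ (weight δ n)))
      ... | no _  = trans (cong (_+ weight δ n * 1) (*-zeroʳ (weight δ n))) (*-identityʳ (weight δ n))

    invariant : ∀ δ n → (∃[ δ′ ] δ′ < δ × Any (Cov δ′ n) (family δ′))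
      ⊎ weight δ n ≡ 2 ^ (D * ∑ δ (λ δ′ → 𝟙 (active? δ′ n)))
    invariant zero n = inj₂ (cong (2 ^_) (sym (*-zeroʳ D)))
    invariant (suc δ) n with invariant δ n
    ... | inj₁ (δ′ , δ′<δ , c) = inj₁ (δ′ , m<n⇒m<1+n δ′<δ , c)
    ... | inj₂ eq with any? (cov? δ n) (family δ)
    ...   | yes c = inj₁ (δ , ≤-refl , c)
    ...   | no ¬c with active? δ n
    ...     | yes _ = inj₂ (trans (cong (λ t → 2 ^ D * (t * 1 * 1) + t * 0) eq)
      (trans (alg (2 ^ D) (2 ^ (D * s))) (trans (sym (^-distribˡ-+-* 2 D (D * s))) (cong (2 ^_) (alg′ D s)))))
      where
      s = ∑ δ (λ δ′ → 𝟙 (active? δ′ n))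
      alg : ∀ x y → x * (y * 1 * 1) + y * 0 ≡ x * y
      alg = solve-∀
      alg′ : ∀ x y → x + x * y ≡ x * (y + 1)
      alg′ = solve-∀
    ...     | no _ = inj₂ (trans (cong (λ t → 2 ^ D * (t * 0 * 1) + t * 1) eq)
      (trans (alg (2 ^ D) (2 ^ (D * s))) (cong (λ t → 2 ^ (D * t)) (sym (+-identityʳ s)))))
      where
      s = ∑ δ (λ δ′ → 𝟙 (active? δ′ n))
      alg : ∀ x y → x * (y * 0 * 1) + y * 1 ≡ y
      alg = solve-∀

  -- An uncovered `n` would carry more weight by itself than the total, which is at most `N`.
  covered : ∀ Δ n → n < N → N < 2 ^ (D * ∑ Δ (λ δ → 𝟙 (active? δ n))) →
    ∃[ δ ] δ < Δ × Any (Cov δ n) (family δ)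
  covered Δ n n<N N< with invariant Δ n
  ... | inj₁ c  = c
  ... | inj₂ eq = contradiction (≤-trans (≤-trans (≤-reflexive (sym eq)) (term≤∑ (weight Δ) n<N)) (total Δ)) (<⇒≱ N<)

-- Sizes and uniqueness of the products c d

division-unique : ∀ {D p q r s} → r < D → s < D → p * D + r ≡ q * D + s → p ≡ q × r ≡ s
division-unique {D} {p} {q} {r} {s} r<D s<D eq with <-cmp p q
... | tri≈ _ refl _ = refl , +-cancelˡ-≡ (p * D) r s eq
... | tri< p<q _ _ = contradiction eq (<⇒≢ (≤-trans (+-monoʳ-< (p * D) r<D)
        (≤-trans (≤-reflexive (+-comm (p * D) D)) (≤-trans (*-monoˡ-≤ D p<q) (m≤m+n (q * D) s)))))
... | tri> _ _ q<p = contradiction (sym eq) (<⇒≢ (≤-trans (+-monoʳ-< (q * D) s<D)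
        (≤-trans (≤-reflexive (+-comm (q * D) D)) (≤-trans (*-monoˡ-≤ D q<p) (m≤m+n (p * D) r)))))

coprime-*ˡ : ∀ {a b c} → Coprime a c → Coprime b c → Coprime (a * b) c
coprime-*ˡ {a} {b} ac bc {d} (d∣ab , d∣c) =
  bc (coprime-divisor (λ (k∣d , k∣a) → ac (k∣a , ∣-trans k∣d d∣c)) d∣ab , d∣c)

coprime-2^ : ∀ k {c} → Coprime 2 c → Coprime (2 ^ k) c
coprime-2^ zero    2c (d∣1 , _) = ∣1⇒≡1 d∣1
coprime-2^ (suc k) 2c = coprime-*ˡ 2c (coprime-2^ k 2c)

-- F stands for 4^Q, and E, P and R for 2^k at the levels k of a = α F E z, c = γ F P x and d = η F R y; all
-- elements on level k are at least 4^k F.  Adding 1 in γ to a multiple of w makes c prime to w.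
module Elements (w : ℕ) where

  α : ℕ → ℕ → ℕ → ℕ
  α F E z = E * F * (E + z)

  γ : ℕ → ℕ → ℕ → ℕ
  γ F P x = w * (P * P * F + x) + 1

  η : ℕ → ℕ → ℕ → ℕ
  η F R y = R * R * F + y

module Size (w F : ℕ) .{{_ : NonZero w}} .{{_ : NonZero F}} where
  open Elements w
  open ≤-Reasoning

  γ-upper : ∀ P x → x < P → γ F P x ≤ w * (P * P * F + P)
  γ-upper P x x<P = begin
    w * (P * P * F + x) + 1    ≤⟨ +-monoʳ-≤ (w * (P * P * F + x)) (>-nonZero⁻¹ w) ⟩
    w * (P * P * F + x) + w    ≡⟨ alg w (P * P * F) x ⟩
    w * (P * P * F + suc x)    ≤⟨ *-monoʳ-≤ w (+-monoʳ-≤ (P * P * F) x<P) ⟩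
    w * (P * P * F + P)        ∎
    where
    alg : ∀ w p x → w * (p + x) + w ≡ w * (p + suc x)
    alg = solve-∀

  γ-upper₂ : ∀ P x .{{_ : NonZero P}} → x < P → γ F P x ≤ 2 * w * (P * P) * F
  γ-upper₂ P x x<P = ≤-trans (γ-upper P x x<P) (begin
    w * (P * P * F + P)              ≤⟨ *-monoʳ-≤ w (+-monoʳ-≤ (P * P * F) (≤-trans (m≤m*n P (P * F) {{m*n≢0 P F}}) (≤-reflexive (sym (*-assoc P P F))))) ⟩
    w * (P * P * F + P * P * F)      ≡⟨ alg w P F ⟩
    2 * w * (P * P) * F              ∎)
    where
    alg : ∀ w P F → w * (P * P * F + P * P * F) ≡ 2 * w * (P * P) * F
    alg = solve-∀

  -- The leading term of c d. It depends on the levels of c and d through `P * R` only, so it is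
  -- common to all splittings used for one n.
  bulk : ℕ → ℕ
  bulk T = w * (T * T * (F * F))

  γη-lower : ∀ P R x y → bulk (P * R) ≤ γ F P x * η F R y
  γη-lower P R x y = begin
    w * (P * R * (P * R) * (F * F)) ≡⟨ alg w P R F ⟩
    w * (P * P * F) * (R * R * F)
      ≤⟨ *-mono-≤ (≤-trans (*-monoʳ-≤ w (m≤m+n (P * P * F) x)) (m≤m+n _ 1)) (m≤m+n (R * R * F) y) ⟩
    γ F P x * η F R y ∎
    where
    alg : ∀ w P R F → w * (P * R * (P * R) * (F * F)) ≡ w * (P * P * F) * (R * R * F)
    alg = solve-∀

  γη-upper : ∀ P R x y → .{{_ : NonZero R}} → P ≤ R → x < P → y ≤ R →
    γ F P x * η F R y ≤ bulk (P * R) + 3 * w * P * R * R * F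
  γη-upper P R x y P≤R x<P y≤R = begin
    γ F P x * η F R y
      ≤⟨ *-mono-≤ (γ-upper P x x<P) (+-monoʳ-≤ (R * R * F) y≤R) ⟩
    w * (P * P * F + P) * (R * R * F + R)
      ≡⟨ alg₁ w P R F ⟩
    bulk (P * R) + (w * P * R * F * P + w * P * R * R * F + w * P * R)
      ≤⟨ +-monoʳ-≤ (bulk (P * R)) (+-mono-≤ (+-monoˡ-≤ (w * P * R * R * F) (*-monoʳ-≤ (w * P * R * F) P≤R))
           (m≤m*n (w * P * R) (R * F) {{m*n≢0 R F}})) ⟩
    bulk (P * R) + (w * P * R * F * R + w * P * R * R * F + w * P * R * (R * F))
      ≡⟨ cong (bulk (P * R) +_) (alg₂ w P R F) ⟩
    bulk (P * R) + 3 * w * P * R * R * F ∎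
    where
    alg₁ : ∀ w P R F → w * (P * P * F + P) * (R * R * F + R)
         ≡ w * (P * R * (P * R) * (F * F)) + (w * P * R * F * P + w * P * R * R * F + w * P * R)
    alg₁ = solve-∀
    alg₂ : ∀ w P R F → w * P * R * F * R + w * P * R * R * F + w * P * R * (R * F) ≡ 3 * w * P * R * R * F
    alg₂ = solve-∀

  -- Since E + z ≤ 2E, this turns a bound on `E * F * b` by the error term into a bound on a b.
  error-small : ∀ E P R → 6 * E ≤ P → 3 * w * P * R * R * F * (2 * E) ≤ bulk (P * R)
  error-small E P R 6E≤P = begin
    3 * w * P * R * R * F * (2 * E)   ≡⟨ alg₁ w P R F E ⟩
    w * P * R * R * F * (6 * E)       ≤⟨ *-monoʳ-≤ (w * P * R * R * F) 6E≤P ⟩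
    w * P * R * R * F * P             ≤⟨ m≤m*n _ F ⟩
    w * P * R * R * F * P * F         ≡⟨ alg₂ w P R F ⟩
    bulk (P * R)                      ∎
    where
    alg₁ : ∀ w P R F E → 3 * w * P * R * R * F * (2 * E) ≡ w * P * R * R * F * (6 * E)
    alg₁ = solve-∀
    alg₂ : ∀ w P R F → w * P * R * R * F * P * F ≡ w * (P * R * (P * R) * (F * F))
    alg₂ = solve-∀

  γη-upper₂ : ∀ E P R x y → .{{_ : NonZero R}} → .{{_ : NonZero E}} → 6 * E ≤ P → P ≤ R → x < P → y ≤ R →
    γ F P x * η F R y ≤ 2 * bulk (P * R)
  γη-upper₂ E P R x y 6E≤P P≤R x<P y≤R = begin
    γ F P x * η F R y                       ≤⟨ γη-upper P R x y P≤R x<P y≤R ⟩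
    bulk (P * R) + 3 * w * P * R * R * F    ≤⟨ +-monoʳ-≤ (bulk (P * R)) (≤-trans (m≤m*n _ (2 * E) {{m*n≢0 2 E}}) (error-small E P R 6E≤P)) ⟩
    bulk (P * R) + bulk (P * R)             ≡⟨ cong (bulk (P * R) +_) (sym (+-identityʳ _)) ⟩
    2 * bulk (P * R)                        ∎

  -- The difference of the two values of c d is at least E F b, which forces b to be small.
  z<z₁⇒small : ∀ E P R P₁ R₁ z z₁ x x₁ y y₁ b .{{_ : NonZero R}} .{{_ : NonZero E}} →
    P * R ≡ P₁ * R₁ → 6 * E ≤ P → P ≤ R → z < E → x < P → y < R →
    α F E z * b + γ F P x * η F R y ≡ α F E z₁ * b + γ F P₁ x₁ * η F R₁ y₁ →
    z < z₁ → α F E z * b + γ F P x * η F R y ≤ 3 * bulk (P * R)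
  z<z₁⇒small E P R P₁ R₁ z z₁ x x₁ y y₁ b PR≡ 6E≤P P≤R z<E x<P y<R eq z<z₁ = begin
    α F E z * b + γ F P x * η F R y    ≤⟨ +-mono-≤ αb-small (γη-upper₂ E P R x y 6E≤P P≤R x<P (<⇒≤ y<R)) ⟩
    bulk (P * R) + 2 * bulk (P * R)    ≡⟨⟩
    3 * bulk (P * R)                   ∎
    where
    err = 3 * w * P * R * R * F
    alg₁ : ∀ E F z b → E * F * (E + z) * b + E * F * b ≡ E * F * (E + suc z) * b
    alg₁ = solve-∀
    alg₂ : ∀ E F z b → E * F * (E + z) * b ≡ E * F * b * (E + z)
    alg₂ = solve-∀
    alg₃ : ∀ a b c → a + b + c ≡ a + (b + c)
    alg₃ = solve-∀
    EFb≤ : E * F * b ≤ err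
    EFb≤ = +-cancelˡ-≤ (bulk (P * R)) _ _ (≤-trans (≤-reflexive (+-comm (bulk (P * R)) _)) (≤-trans step (γη-upper P R x y P≤R x<P (<⇒≤ y<R))))
      where
      step : E * F * b + bulk (P * R) ≤ γ F P x * η F R y
      step = +-cancelˡ-≤ (α F E z * b) _ _ (begin
        α F E z * b + (E * F * b + bulk (P * R))      ≡⟨ sym (alg₃ (α F E z * b) _ _) ⟩
        α F E z * b + E * F * b + bulk (P * R)        ≡⟨ cong₂ _+_ (alg₁ E F z b) (cong bulk PR≡) ⟩
        E * F * (E + suc z) * b + bulk (P₁ * R₁)      ≤⟨ +-mono-≤ (*-monoˡ-≤ b (*-monoʳ-≤ (E * F) (+-monoʳ-≤ E z<z₁))) (γη-lower P₁ R₁ x₁ y₁) ⟩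
        α F E z₁ * b + γ F P₁ x₁ * η F R₁ y₁          ≡⟨ sym eq ⟩
        α F E z * b + γ F P x * η F R y               ∎)
    αb-small : α F E z * b ≤ bulk (P * R)
    αb-small = begin
      E * F * (E + z) * b     ≡⟨ alg₂ E F z b ⟩
      E * F * b * (E + z)     ≤⟨ *-mono-≤ EFb≤ (≤-trans (+-monoʳ-≤ E (<⇒≤ z<E)) (≤-reflexive (cong (E +_) (sym (+-identityʳ E))))) ⟩
      err * (2 * E)           ≤⟨ error-small E P R 6E≤P ⟩
      bulk (P * R)            ∎

  -- After removing w (P R)² F², the product c d is (w x + 1) R² F plus a remainder below R₁² F.
  cd-unique : ∀ k P R₁ x x₁ y y₁ .{{_ : NonZero P}} .{{_ : NonZero R₁}} → 2 ∣ w →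
    let J = 2 ^ k; P₁ = P * J; R = R₁ * J in
    2 * w * (P * P) * R ≤ R₁ * R₁ → 2 * w * (P₁ * P₁) ≤ R₁ →
    x < P → x₁ < P₁ → y < R → y₁ < R₁ →
    γ F P x * η F R y ≡ γ F P₁ x₁ * η F R₁ y₁ → k ≡ 0 × x ≡ x₁ × y ≡ y₁
  cd-unique k P R₁ x x₁ y y₁ 2∣w small small₁ x<P x₁<P₁ y<R y₁<R₁ eq =
    conclude k refl (division-unique rest<D rest₁<D split)
    where
    J = 2 ^ k
    P₁ = P * J
    R = R₁ * J
    D = R₁ * R₁ * F
    instance
      J≢0 : NonZero J
      J≢0 = m^n≢0 2 k
      P₁≢0 : NonZero P₁
      P₁≢0 = m*n≢0 P J
    alg₁ : ∀ w P J R F x y → (w * (P * P * F + x) + 1) * (R * J * (R * J) * F + y)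
         ≡ (1 + x * w) * (J * J) * (R * R * F) + y * (w * (P * P * F + x) + 1) + w * P * P * F * R * R * F * J * J
    alg₁ = solve-∀
    alg₂ : ∀ w P J R F x y → (w * (P * J * (P * J) * F + x) + 1) * (R * R * F + y)
         ≡ (1 + x * w) * (R * R * F) + y * (w * (P * J * (P * J) * F + x) + 1) + w * P * P * F * R * R * F * J * J
    alg₂ = solve-∀
    split : (1 + x * w) * (J * J) * D + y * γ F P x ≡ (1 + x₁ * w) * D + y₁ * γ F P₁ x₁
    split = +-cancelʳ-≡ (w * P * P * F * R₁ * R₁ * F * J * J) _ _
      (trans (sym (alg₁ w P J R₁ F x y)) (trans eq (alg₂ w P J R₁ F x₁ y₁)))
    γ≢0 : ∀ P x → NonZero (γ F P x)
    γ≢0 P x = >-nonZero (m≤n+m 1 (w * (P * P * F + x)))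
    alg₃ : ∀ R w P F → R * (2 * w * (P * P) * F) ≡ 2 * w * (P * P) * R * F
    alg₃ = solve-∀
    rest<D : y * γ F P x < D
    rest<D = begin-strict
      y * γ F P x                    <⟨ *-monoˡ-< (γ F P x) {{γ≢0 P x}} y<R ⟩
      R * γ F P x                    ≤⟨ *-monoʳ-≤ R (γ-upper₂ P x x<P) ⟩
      R * (2 * w * (P * P) * F)      ≡⟨ alg₃ R w P F ⟩
      2 * w * (P * P) * R * F        ≤⟨ *-monoˡ-≤ F small ⟩
      D                              ∎
    rest₁<D : y₁ * γ F P₁ x₁ < D
    rest₁<D = begin-strict
      y₁ * γ F P₁ x₁                 <⟨ *-monoˡ-< (γ F P₁ x₁) {{γ≢0 P₁ x₁}} y₁<R₁ ⟩
      R₁ * γ F P₁ x₁                 ≤⟨ *-monoʳ-≤ R₁ (γ-upper₂ P₁ x₁ x₁<P₁) ⟩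
      R₁ * (2 * w * (P₁ * P₁) * F)   ≡⟨ sym (*-assoc R₁ _ F) ⟩
      R₁ * (2 * w * (P₁ * P₁)) * F   ≤⟨ *-monoˡ-≤ F (*-monoʳ-≤ R₁ small₁) ⟩
      D                              ∎
    conclude : ∀ j → k ≡ j → (1 + x * w) * (J * J) ≡ 1 + x₁ * w × y * γ F P x ≡ y₁ * γ F P₁ x₁ → k ≡ 0 × x ≡ x₁ × y ≡ y₁
    conclude zero refl (hx , hy) = refl , x≡x₁ , y≡y₁
      where
      x≡x₁ : x ≡ x₁
      x≡x₁ = *-cancelʳ-≡ x x₁ w (+-cancelˡ-≡ 1 _ _ (trans (sym (*-identityʳ (1 + x * w))) hx))
      y≡y₁ : y ≡ y₁
      y≡y₁ = *-cancelʳ-≡ y y₁ (γ F P x) {{γ≢0 P x}} (trans hy (cong₂ (λ p t → y₁ * γ F p t) (*-identityʳ P) (sym x≡x₁)))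
    -- If the levels differed, `J` would make the left quotient even, whereas `1 + x₁ * w` is odd.
    conclude (suc j) refl (hx , _) = contradiction (∣1⇒≡1 2∣1) λ ()
      where
      2∣1 : 2 ∣ 1
      2∣1 = ∣m+n∣m⇒∣n (subst (2 ∣_) (trans hx (+-comm 1 (x₁ * w)))
        (∣n⇒∣m*n (1 + x * w) (∣m⇒∣m*n J (m∣m*n (2 ^ j))))) (∣n⇒∣m*n x₁ 2∣w)

-- Many candidates b for a given n and a given level of a

-- Here n = a b + c d with a, b, c and d on the levels e, δ, cLevel i and dLevel i respectively, where i < h.
module Candidates
  (w ω V q h s e δ n : ℕ) .{{_ : NonZero w}}
  (w-divisible : ∀ m → 0 < m → m < 13 → m ∣ w) (2w≤2^ω : 2 * w ≤ 2 ^ ω) (8w≤V : 8 * w ≤ V)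
  (h≡ : h ≡ 2 ^ q * 2 ^ q) (q≤h : q ≤ h)
  (e<h : e < h) (e+δ≡s : e + δ ≡ s) (s-large : 6 * h + 6 + ω ≤ s)
  (n-lower : V * (2 ^ s * 2 ^ s * (2 ^ q * 2 ^ q)) ≤ n)
  (n-upper : n < 4 * V * (2 ^ s * 2 ^ s * (2 ^ q * 2 ^ q)))
  where

  open Elements w
  private
    F = 2 ^ q
    E = 2 ^ e
    T = 2 ^ s
    Δ = 2 ^ δ

    instance
      E≢0 : NonZero E
      E≢0 = m^n≢0 2 e
      F≢0 : NonZero F
      F≢0 = m^n≢0 2 q
      T≢0 : NonZero T
      T≢0 = m^n≢0 2 s

  open Size w F

  -- The offset h + 3 gives P ≥ 8E for every e < h, which secures the bound 6E ≤ P of the size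
  -- estimates.
  cLevel dLevel : ℕ → ℕ
  cLevel i = h + (3 + i)
  dLevel i = s ∸ cLevel i

  private
    P R : ℕ → ℕ
    P i = 2 ^ cLevel i
    R i = 2 ^ dLevel i

    instance
      P≢0 : ∀ {i} → NonZero (P i)
      P≢0 {i} = m^n≢0 2 (cLevel i)
      R≢0 : ∀ {i} → NonZero (R i)
      R≢0 {i} = m^n≢0 2 (dLevel i)

    2∣w : 2 ∣ w
    2∣w = w-divisible 2 z<s (s≤s (s≤s (s≤s z≤n)))

    cLevel≤ : ∀ {i} → i < h → cLevel i ≤ 2 + h + h
    cLevel≤ i<h = ≤-trans (+-monoʳ-≤ h (+-monoʳ-≤ 2 i<h)) (≤-reflexive (alg h))
      where
      alg : ∀ h → h + (2 + h) ≡ 2 + h + h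
      alg = solve-∀

    -- The uniqueness of c d asks for 2 w P^2 ≤ R, that is, ω plus three levels of c must not exceed
    -- s. Each such level is at most 2h + 2, which is the origin of `6 * h + 6 + ω`.
    levels≤s : ∀ {i j k} → i < h → j < h → k < h → ω + cLevel i + (cLevel j + cLevel k) ≤ s
    levels≤s i<h j<h k<h = ≤-trans (+-mono-≤ (+-monoʳ-≤ ω (cLevel≤ i<h)) (+-mono-≤ (cLevel≤ j<h) (cLevel≤ k<h)))
      (≤-trans (≤-reflexive (alg ω h)) s-large)
      where
      alg : ∀ ω h → ω + (2 + h + h) + (2 + h + h + (2 + h + h)) ≡ 6 * h + 6 + ω
      alg = solve-∀

  cLevel≤s : ∀ {i} → i < h → cLevel i ≤ s
  cLevel≤s {i} i<h = ≤-trans (m≤n+m (cLevel i) ω) (m+n≤o⇒m≤o (ω + cLevel i) (levels≤s i<h i<h i<h))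

  private
    level-sum : ∀ {i} → i < h → cLevel i + dLevel i ≡ s
    level-sum i<h = m+[n∸m]≡n (cLevel≤s i<h)

    PR≡T : ∀ {i} → i < h → P i * R i ≡ T
    PR≡T {i} i<h = trans (sym (^-distribˡ-+-* 2 (cLevel i) (dLevel i))) (cong (2 ^_) (level-sum i<h))

    6E≤P : ∀ i → 6 * E ≤ P i
    6E≤P i = begin
      6 * E           ≤⟨ *-monoˡ-≤ E (m≤n+m 6 2) ⟩
      8 * E           ≡⟨ sym (^-distribˡ-+-* 2 3 e) ⟩
      2 ^ (3 + e)     ≤⟨ ^-monoʳ-≤ 2 (≤-trans (≤-reflexive (+-comm 3 e)) (+-mono-≤ (<⇒≤ e<h) (m≤m+n 3 i))) ⟩
      P i             ∎
      where open ≤-Reasoning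

    P≤R : ∀ {i} → i < h → P i ≤ R i
    P≤R {i} i<h = ^-monoʳ-≤ 2 (+-cancelˡ-≤ (cLevel i) _ _
      (≤-trans (m≤n+m _ (ω + cLevel i)) (≤-trans (levels≤s i<h i<h i<h) (≤-reflexive (sym (level-sum i<h))))))

    bulk≡ : ∀ {i} → i < h → bulk (P i * R i) ≡ w * (T * T * (F * F))
    bulk≡ i<h = cong bulk (PR≡T i<h)

    3bulk<n : 3 * bulk T < n
    3bulk<n = begin-strict
      3 * bulk T                         ≡⟨ sym (*-assoc 3 w _) ⟩
      3 * w * (T * T * (F * F))          <⟨ *-monoˡ-< (T * T * (F * F)) {{m*n≢0 (T * T) (F * F) {{m*n≢0 T T}} {{m*n≢0 F F}}}} (*-monoˡ-< w {3} {8} (s≤s (s≤s (s≤s (s≤s z≤n))))) ⟩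
      8 * w * (T * T * (F * F))          ≤⟨ *-monoˡ-≤ (T * T * (F * F)) 8w≤V ⟩
      V * (T * T * (F * F))              ≤⟨ n-lower ⟩
      n                                  ∎
      where open ≤-Reasoning

  Rep : ℕ → ℕ → ℕ → ℕ → ℕ → Set
  Rep i z x y b = n ≡ α F E z * b + γ F (P i) x * η F (R i) y

  rep? : ∀ i z x y b → Dec (Rep i z x y b)
  rep? i z x y b = n ≟ α F E z * b + γ F (P i) x * η F (R i) y

  InBox : ℕ → ℕ → ℕ → ℕ → Set
  InBox i z x y = i < h × z < E × x < P i × y < R i

  private
    z≮z₁ : ∀ {i z x y i₁ z₁ x₁ y₁ b} → InBox i z x y → InBox i₁ z₁ x₁ y₁ →
      Rep i z x y b → Rep i₁ z₁ x₁ y₁ b → ¬ z < z₁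
    z≮z₁ {i} {z} {x} {y} {i₁} {z₁} {x₁} {y₁} {b} (i<h , z<E , x<P , y<R) (i₁<h , _) r r₁ z<z₁ =
      <⇒≱ 3bulk<n (≤-trans (≤-reflexive r) (≤-trans
        (z<z₁⇒small E (P i) (R i) (P i₁) (R i₁) z z₁ x x₁ y y₁ b (trans (PR≡T i<h) (sym (PR≡T i₁<h)))
          (6E≤P i) (P≤R i<h) z<E x<P y<R (trans (sym r) r₁) z<z₁)
        (≤-reflexive (cong (3 *_) (bulk≡ i<h)))))

    cd-unique′ : ∀ {i k x y x₁ y₁} → i < h → i + k < h → x < P i → x₁ < P (i + k) → y < R i → y₁ < R (i + k) →
      γ F (P i) x * η F (R i) y ≡ γ F (P (i + k)) x₁ * η F (R (i + k)) y₁ → k ≡ 0 × x ≡ x₁ × y ≡ y₁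
    cd-unique′ {i} {k} {x} {y} {x₁} {y₁} i<h i₁<h x<P x₁<P₁ y<R y₁<R₁ eq =
      cd-unique k (P i) (R (i + k)) x x₁ y y₁ 2∣w
        (subst (λ r → 2 * w * (P i * P i) * r ≤ R (i + k) * R (i + k)) R≡ small)
        (subst (λ p → 2 * w * (p * p) ≤ R (i + k)) P≡ small₁)
        x<P (subst (x₁ <_) P≡ x₁<P₁) (subst (y <_) R≡ y<R) y₁<R₁
        (trans (cong (λ r → γ F (P i) x * η F r y) (sym R≡)) (trans eq (cong (λ p → γ F p x₁ * η F (R (i + k)) y₁) P≡)))
      where
      P≡ : P (i + k) ≡ P i * 2 ^ k
      P≡ = trans (cong (2 ^_) (alg h i k)) (^-distribˡ-+-* 2 (cLevel i) k)
        where
        alg : ∀ h i k → h + (3 + (i + k)) ≡ h + (3 + i) + k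
        alg = solve-∀
      d≡ : dLevel i ≡ dLevel (i + k) + k
      d≡ = +-cancelˡ-≡ (cLevel i) _ _ (trans (level-sum i<h) (trans (sym (level-sum i₁<h)) (alg h i k (dLevel (i + k)))))
        where
        alg : ∀ h i k d → h + (3 + (i + k)) + d ≡ h + (3 + i) + (d + k)
        alg = solve-∀
      R≡ : R i ≡ R (i + k) * 2 ^ k
      R≡ = trans (cong (2 ^_) d≡) (^-distribˡ-+-* 2 (dLevel (i + k)) k)
      open ≤-Reasoning
      2^-+₂ : ∀ a b c → 2 ^ a * (2 ^ b * 2 ^ c) ≡ 2 ^ (a + (b + c))
      2^-+₂ a b c = trans (cong (2 ^ a *_) (sym (^-distribˡ-+-* 2 b c))) (sym (^-distribˡ-+-* 2 a (b + c)))
      small : 2 * w * (P i * P i) * R i ≤ R (i + k) * R (i + k)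
      small = begin
        2 * w * (P i * P i) * R i           ≤⟨ *-monoˡ-≤ (R i) (*-monoˡ-≤ (P i * P i) 2w≤2^ω) ⟩
        2 ^ ω * (P i * P i) * R i           ≡⟨ cong (_* R i) (2^-+₂ ω (cLevel i) (cLevel i)) ⟩
        2 ^ (ω + (cLevel i + cLevel i)) * R i ≡⟨ sym (^-distribˡ-+-* 2 (ω + (cLevel i + cLevel i)) (dLevel i)) ⟩
        2 ^ (ω + (cLevel i + cLevel i) + dLevel i) ≤⟨ ^-monoʳ-≤ 2 exponents ⟩
        2 ^ (dLevel (i + k) + dLevel (i + k)) ≡⟨ ^-distribˡ-+-* 2 (dLevel (i + k)) _ ⟩
        R (i + k) * R (i + k)               ∎
        where
        alg₁ : ∀ ω c d c₁ → c₁ + c₁ + (ω + (c + c) + d) ≡ ω + c + (c₁ + c₁) + (c + d)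
        alg₁ = solve-∀
        alg₂ : ∀ c d → (c + d) + (c + d) ≡ c + c + (d + d)
        alg₂ = solve-∀
        exponents : ω + (cLevel i + cLevel i) + dLevel i ≤ dLevel (i + k) + dLevel (i + k)
        exponents = +-cancelˡ-≤ (cLevel (i + k) + cLevel (i + k)) _ _ (begin
          cLevel (i + k) + cLevel (i + k) + (ω + (cLevel i + cLevel i) + dLevel i)
            ≡⟨ alg₁ ω (cLevel i) (dLevel i) (cLevel (i + k)) ⟩
          ω + cLevel i + (cLevel (i + k) + cLevel (i + k)) + (cLevel i + dLevel i)
            ≤⟨ +-mono-≤ (levels≤s i<h i₁<h i₁<h) (≤-reflexive (level-sum i<h)) ⟩
          s + s
            ≡⟨ cong₂ _+_ (sym (level-sum i₁<h)) (sym (level-sum i₁<h)) ⟩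
          (cLevel (i + k) + dLevel (i + k)) + (cLevel (i + k) + dLevel (i + k))
            ≡⟨ alg₂ (cLevel (i + k)) (dLevel (i + k)) ⟩
          cLevel (i + k) + cLevel (i + k) + (dLevel (i + k) + dLevel (i + k)) ∎)
      small₁ : 2 * w * (P (i + k) * P (i + k)) ≤ R (i + k)
      small₁ = begin
        2 * w * (P (i + k) * P (i + k))     ≤⟨ *-monoˡ-≤ (P (i + k) * P (i + k)) 2w≤2^ω ⟩
        2 ^ ω * (P (i + k) * P (i + k))     ≡⟨ 2^-+₂ ω (cLevel (i + k)) (cLevel (i + k)) ⟩
        2 ^ (ω + (cLevel (i + k) + cLevel (i + k))) ≤⟨ ^-monoʳ-≤ 2 (+-cancelˡ-≤ (cLevel (i + k)) _ _
            (≤-trans (≤-reflexive (alg ω (cLevel (i + k)))) (≤-trans (levels≤s i₁<h i₁<h i₁<h) (≤-reflexive (sym (level-sum i₁<h)))))) ⟩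
        R (i + k)                           ∎
        where
        alg : ∀ ω c → c + (ω + (c + c)) ≡ ω + c + (c + c)
        alg = solve-∀

  private
    cd-unique-≤ : ∀ {i i₁ x y x₁ y₁} → i < h → i₁ < h → x < P i → x₁ < P i₁ → y < R i → y₁ < R i₁ → i ≤ i₁ →
      γ F (P i) x * η F (R i) y ≡ γ F (P i₁) x₁ * η F (R i₁) y₁ → i ≡ i₁ × x ≡ x₁ × y ≡ y₁
    cd-unique-≤ {i} {i₁} {x} {y} {x₁} {y₁} i<h i₁<h x<P x₁<P y<R y₁<R i≤i₁ eq = shift (m≤n⇒∃[o]m+o≡n i≤i₁)
      where
      shift : (∃[ k ] i + k ≡ i₁) → i ≡ i₁ × x ≡ x₁ × y ≡ y₁
      shift (k , refl) = map₁ (λ k≡0 → sym (trans (cong (i +_) k≡0) (+-identityʳ i)))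
        (cd-unique′ i<h i₁<h x<P x₁<P y<R y₁<R eq)

    z-equal : ∀ {i z x y i₁ z₁ x₁ y₁ b} → InBox i z x y → InBox i₁ z₁ x₁ y₁ →
      Rep i z x y b → Rep i₁ z₁ x₁ y₁ b → z ≡ z₁
    z-equal box box₁ r r₁ = ≤-antisym (≮⇒≥ (z≮z₁ box₁ box r₁ r)) (≮⇒≥ (z≮z₁ box box₁ r r₁))

    cd-equal : ∀ {i z x y i₁ x₁ y₁ b} → Rep i z x y b → Rep i₁ z x₁ y₁ b →
      γ F (P i) x * η F (R i) y ≡ γ F (P i₁) x₁ * η F (R i₁) y₁
    cd-equal {z = z} {b = b} r r₁ = +-cancelˡ-≡ (α F E z * b) _ _ (trans (sym r) r₁)

    order : ∀ {i x y i₁ x₁ y₁} → i < h → i₁ < h → x < P i → x₁ < P i₁ → y < R i → y₁ < R i₁ →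
      γ F (P i) x * η F (R i) y ≡ γ F (P i₁) x₁ * η F (R i₁) y₁ → i ≤ i₁ ⊎ i₁ ≤ i → i ≡ i₁ × x ≡ x₁ × y ≡ y₁
    order i<h i₁<h x<P x₁<P y<R y₁<R eq (inj₁ i≤i₁) = cd-unique-≤ i<h i₁<h x<P x₁<P y<R y₁<R i≤i₁ eq
    order i<h i₁<h x<P x₁<P y<R y₁<R eq (inj₂ i₁≤i) = map sym (map sym sym)
      (cd-unique-≤ i₁<h i<h x₁<P x<P y₁<R y<R i₁≤i (sym eq))

  -- This makes the count of quadruples a count of distinct b. Two different a would force n ≤ 3
  -- `bulk T`, against the size of n; with a fixed, the value of c d is known, and it determines the
  -- splitting, x and y.
  rep-unique : ∀ {i z x y i₁ z₁ x₁ y₁ b} → InBox i z x y → InBox i₁ z₁ x₁ y₁ →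
    Rep i z x y b → Rep i₁ z₁ x₁ y₁ b → i ≡ i₁ × z ≡ z₁ × x ≡ x₁ × y ≡ y₁
  rep-unique {i} {z} {x} {y} {i₁} {z₁} {x₁} {y₁} {b} box@(i<h , z<E , x<P , y<R) box₁@(i₁<h , z₁<E , x₁<P , y₁<R) r r₁ =
    proj₁ rest , z≡z₁ , proj₂ rest
    where
    z≡z₁ : z ≡ z₁
    z≡z₁ = z-equal {i} {z} {x} {y} {i₁} {z₁} {x₁} {y₁} {b} box box₁ r r₁
    rest : i ≡ i₁ × x ≡ x₁ × y ≡ y₁
    rest = order i<h i₁<h x<P x₁<P y<R y₁<R
      (cd-equal {i} {z} {x} {y} {i₁} {x₁} {y₁} {b} r (subst (λ z → Rep i₁ z x₁ y₁ b) (sym z≡z₁) r₁)) (≤-total i i₁)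

  private
    tsum : ℕ → ℕ
    tsum b = ∑ h λ i → ∑ E λ z → ∑ (P i) λ x → ∑ (R i) λ y → 𝟙 (rep? i z x y b)

    pos₄ : ∀ {b i z x} → 0 < ∑ (R i) (λ y → 𝟙 (rep? i z x y b)) → ∃[ y ] y < R i × Rep i z x y b
    pos₄ {b} {i} {z} {x} p with y , y<R , q ← ∑-pos (R i) _ p = y , y<R , 𝟙-pos⇒ (rep? i z x y b) q

    pos₃ : ∀ {b i z} → 0 < (∑ (P i) λ x → ∑ (R i) λ y → 𝟙 (rep? i z x y b)) →
      ∃[ x ] x < P i × ∃[ y ] y < R i × Rep i z x y b
    pos₃ {i = i} p with x , x<P , q ← ∑-pos (P i) _ p = x , x<P , pos₄ q

    pos₂ : ∀ {b i} → 0 < (∑ E λ z → ∑ (P i) λ x → ∑ (R i) λ y → 𝟙 (rep? i z x y b)) →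
      ∃[ z ] z < E × ∃[ x ] x < P i × ∃[ y ] y < R i × Rep i z x y b
    pos₂ p with z , z<E , q ← ∑-pos E _ p = z , z<E , pos₃ q

    tsum-pos : ∀ {b} → 0 < tsum b → ∃[ i ] ∃[ z ] ∃[ x ] ∃[ y ] InBox i z x y × Rep i z x y b
    tsum-pos p with i , i<h , q ← ∑-pos h _ p with z , z<E , x , x<P , y , y<R , r ← pos₂ q =
      i , z , x , y , (i<h , z<E , x<P , y<R) , r

    tsum≤1 : ∀ b → tsum b ≤ 1
    tsum≤1 b =
      ∑-atMostOne h _ (λ i i<h →
        ∑-atMostOne E _ (λ z z<E →
          ∑-atMostOne (P i) _ (λ x x<P →
            ∑-atMostOne (R i) _ (λ y _ → 𝟙≤1 (rep? i z x y b))
              λ y y₁ y<R y₁<R p p₁ → proj₂ (proj₂ (proj₂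
                (rep-unique (i<h , z<E , x<P , y<R) (i<h , z<E , x<P , y₁<R)
                  (𝟙-pos⇒ (rep? i z x y b) p) (𝟙-pos⇒ (rep? i z x y₁ b) p₁)))))
            λ x x₁ x<P x₁<P p p₁ → let y , y<R , r = pos₄ p; y₁ , y₁<R , r₁ = pos₄ p₁ in proj₁ (proj₂ (proj₂
              (rep-unique (i<h , z<E , x<P , y<R) (i<h , z<E , x₁<P , y₁<R) r r₁))))
          λ z z₁ z<E z₁<E p p₁ → let x , x<P , y , y<R , r = pos₃ p; x₁ , x₁<P , y₁ , y₁<R , r₁ = pos₃ p₁ in proj₁ (proj₂
            (rep-unique (i<h , z<E , x<P , y<R) (i<h , z₁<E , x₁<P , y₁<R) r r₁)))
        λ i i₁ i<h i₁<h p p₁ → let z , z<E , x , x<P , y , y<R , r = pos₂ p; z₁ , z₁<E , x₁ , x₁<P , y₁ , y₁<R , r₁ = pos₂ p₁ in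
          proj₁ (rep-unique (i<h , z<E , x<P , y<R) (i₁<h , z₁<E , x₁<P , y₁<R) r r₁)

  range : ℕ
  range = 4 * V * (Δ * Δ * F)

  private
    2∤γ : ∀ p x → Coprime 2 (γ F p x)
    2∤γ p x (d∣2 , d∣γ) = ∣1⇒≡1 (∣m+n∣m⇒∣n d∣γ (∣m⇒∣m*n (p * p * F + x) (∣-trans d∣2 2∣w)))

    α-coprime : ∀ z c → Coprime 2 c → Coprime (E + z) c → Coprime (α F E z) c
    α-coprime z c 2c zc = coprime-*ˡ (coprime-*ˡ (coprime-2^ e 2c) (coprime-2^ q 2c)) zc

    α≢0 : ∀ z → NonZero (α F E z)
    α≢0 z = m*n≢0 (E * F) (E + z) {{m*n≢0 E F}} {{>-nonZero (≤-trans (>-nonZero⁻¹ E) (m≤m+n E z))}}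

    -- A bound for every a of the level. It is a power of two, so that it divides `R i` and the
    -- interval of y splits into whole blocks.
    block : ℕ
    block = 2 * (E * E * F)

    α≤block : ∀ {z} → z < E → α F E z ≤ block
    α≤block {z} z<E = begin
      E * F * (E + z)   ≤⟨ *-monoʳ-≤ (E * F) (+-monoʳ-≤ E (<⇒≤ z<E)) ⟩
      E * F * (E + E)   ≡⟨ alg E F ⟩
      2 * (E * E * F)   ∎
      where
      open ≤-Reasoning
      alg : ∀ E F → E * F * (E + E) ≡ 2 * (E * E * F)
      alg = solve-∀

    b<range : ∀ {z b t} → n ≡ α F E z * b + t → b < range
    b<range {z} {b} {t} eq = *-cancelˡ-< (E * E * F) _ _ (begin-strict
      E * E * F * b                   ≤⟨ *-monoˡ-≤ b (≤-trans (≤-reflexive (alg₁ E F)) (*-monoʳ-≤ (E * F) (m≤m+n E z))) ⟩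
      α F E z * b                     ≤⟨ m≤m+n _ t ⟩
      α F E z * b + t                 ≡⟨ sym eq ⟩
      n                               <⟨ n-upper ⟩
      4 * V * (T * T * (F * F))       ≡⟨ cong (λ t → 4 * V * (t * t * (F * F))) (trans (cong (2 ^_) (sym e+δ≡s)) (^-distribˡ-+-* 2 e δ)) ⟩
      4 * V * (E * Δ * (E * Δ) * (F * F)) ≡⟨ alg₂ V E Δ F ⟩
      E * E * F * range               ∎)
      where
      open ≤-Reasoning
      alg₁ : ∀ E F → E * E * F ≡ E * F * E
      alg₁ = solve-∀
      alg₂ : ∀ V E Δ F → 4 * V * (E * Δ * (E * Δ) * (F * F)) ≡ E * E * F * (4 * V * (Δ * Δ * F))
      alg₂ = solve-∀

    gLevel : ∀ {i} → i < h → ∃[ g ] R i ≡ 2 ^ g * block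
    gLevel {i} i<h = factor (m≤n⇒∃[o]m+o≡n (+-cancelˡ-≤ (cLevel i) _ _ bound))
      where
      open ≤-Reasoning
      alg : ∀ h ω → 2 + h + h + (1 + (h + h + h)) + (h + 3 + ω) ≡ 6 * h + 6 + ω
      alg = solve-∀
      bound : cLevel i + (1 + (e + e + q)) ≤ cLevel i + dLevel i
      bound = begin
        cLevel i + (1 + (e + e + q))  ≤⟨ +-mono-≤ (cLevel≤ i<h) (s≤s (+-mono-≤ (+-mono-≤ (<⇒≤ e<h) (<⇒≤ e<h)) q≤h)) ⟩
        2 + h + h + (1 + (h + h + h)) ≤⟨ m≤m+n _ (h + 3 + ω) ⟩
        2 + h + h + (1 + (h + h + h)) + (h + 3 + ω) ≡⟨ alg h ω ⟩
        6 * h + 6 + ω                 ≤⟨ s-large ⟩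
        s                             ≡⟨ sym (level-sum i<h) ⟩
        cLevel i + dLevel i           ∎
      factor : (∃[ g ] 1 + (e + e + q) + g ≡ dLevel i) → ∃[ g ] R i ≡ 2 ^ g * block
      factor (g , eq) = g , trans (cong (2 ^_) (trans (sym eq) (+-comm _ g)))
        (trans (^-distribˡ-+-* 2 g _) (cong (λ t → 2 ^ g * (2 * t))
          (trans (^-distribˡ-+-* 2 (e + e) q) (cong (_* F) (^-distribˡ-+-* 2 e e)))))

    -- One solution per block of `block` consecutive values of y.
    solutions : ∀ {i z x} → i < h → z < E → x < P i →
      R i * 𝟙 (coprime? (E + z) (γ F (P i) x)) ≤ block * (∑ (R i) λ y → ∑ range λ b → 𝟙 (rep? i z x y b))
    solutions {i} {z} {x} i<h z<E x<P with coprime? (E + z) (γ F (P i) x)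
    ... | no _ = ≤-trans (≤-reflexive (*-zeroʳ (R i))) z≤n
    ... | yes cop with g , R≡ ← gLevel i<h = begin
      R i * 1                  ≡⟨ trans (*-identityʳ (R i)) (trans R≡ (*-comm (2 ^ g) block)) ⟩
      block * 2 ^ g            ≤⟨ *-monoʳ-≤ block hits ⟩
      block * ∑ (R i) f        ∎
      where
      open ≤-Reasoning
      a = α F E z
      c = γ F (P i) x
      f : ℕ → ℕ
      f y = ∑ range λ b → 𝟙 (rep? i z x y b)
      each : ∀ k → k < 2 ^ g → 1 ≤ ∑ block (λ j → f (k * block + j))
      -- The start of the block goes into `base`, and the congruence is solved for the offset within
      -- the block. Its size condition is `room`: c d stays below 2 `bulk T`, or equals it, and n is
      -- larger.
      each k k<G = found (linear-congruence a c r {{α≢0 z}} (α-coprime z c (2∤γ (P i) x) cop)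
        (+-cancelʳ-≤ (c * base) _ _ (≤-trans (≤-trans (≤-reflexive (sym (*-distribˡ-+ c a base))) room) (≤-reflexive (sym (m∸n+n≡m c*base≤n))))))
        where
        base = η F (R i) (k * block)
        r = n ∸ c * base
        room : c * (a + base) ≤ n
        room = begin
          c * (a + base)                     ≤⟨ *-monoʳ-≤ c (≤-trans (+-monoˡ-≤ base (α≤block z<E)) (≤-reflexive (alg block (R i * R i * F) (k * block)))) ⟩
          c * η F (R i) (block + k * block)  ≤⟨ γη-upper₂ E (P i) (R i) x _ (6E≤P i) (P≤R i<h) x<P (≤-trans (*-monoˡ-≤ block k<G) (≤-reflexive (sym R≡))) ⟩
          2 * bulk (P i * R i)               ≡⟨ cong (2 *_) (bulk≡ i<h) ⟩
          2 * bulk T                         ≤⟨ *-monoˡ-≤ (bulk T) (n≤1+n 2) ⟩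
          3 * bulk T                         ≤⟨ <⇒≤ 3bulk<n ⟩
          n                                  ∎
          where
          alg : ∀ b r k → b + (r + k) ≡ r + (b + k)
          alg = solve-∀
        c*base≤n : c * base ≤ n
        c*base≤n = ≤-trans (*-monoʳ-≤ c (m≤n+m base a)) room
        found : (∃[ y ] y < a × ∃[ b ] r ≡ a * b + c * y) → 1 ≤ ∑ block (λ j → f (k * block + j))
        found (y , y<a , b , eq) = begin
          1                                        ≡⟨ sym (𝟙-yes (rep? i z x (k * block + y) b) rep) ⟩
          𝟙 (rep? i z x (k * block + y) b)         ≤⟨ term≤∑ (λ b → 𝟙 (rep? i z x (k * block + y) b)) (b<range {z} {b} rep) ⟩
          f (k * block + y)                        ≤⟨ term≤∑ (λ j → f (k * block + j)) (≤-trans y<a (α≤block z<E)) ⟩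
          ∑ block (λ j → f (k * block + j))        ∎
          where
          alg : ∀ a b c y u v → a * b + c * y + c * (u + v) ≡ a * b + c * (u + (v + y))
          alg = solve-∀
          rep : Rep i z x (k * block + y) b
          rep = trans (sym (m∸n+n≡m c*base≤n)) (trans (cong (_+ c * base) eq) (alg a b c y (R i * R i * F) (k * block)))
      hits : 2 ^ g ≤ ∑ (R i) f
      hits = begin
        2 ^ g                                              ≡⟨ sym (trans (∑-const (2 ^ g) 1) (*-identityʳ _)) ⟩
        ∑ (2 ^ g) (λ _ → 1)                                ≤⟨ ∑-mono (2 ^ g) each ⟩
        ∑ (2 ^ g) (λ k → ∑ block (λ j → f (k * block + j))) ≡⟨ sym (∑-blocks (2 ^ g) block f) ⟩
        ∑ (2 ^ g * block) f                                ≡⟨ cong (λ t → ∑ t f) (sym R≡) ⟩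
        ∑ (R i) f                                          ∎

    tsum-swap : ∑ range tsum ≡ ∑ h λ i → ∑ E λ z → ∑ (P i) λ x → ∑ (R i) λ y → ∑ range λ b → 𝟙 (rep? i z x y b)
    tsum-swap = trans (∑-swap range h _) (∑-cong h λ i _ →
      trans (∑-swap range E _) (∑-cong E λ z _ →
        trans (∑-swap range (P i) _) (∑-cong (P i) λ x _ → ∑-swap range (R i) _)))

    -- On each of the h splittings at least half of the E P pairs (z, x) are coprime, each of these
    -- yields at least R / `block` solutions, and P R = T.
    many : h * (E * T) ≤ 2 * (block * ∑ range tsum)
    many = begin
      h * (E * T)
        ≡⟨ sym (∑-const h (E * T)) ⟩
      ∑ h (λ _ → E * T)
        ≤⟨ ∑-mono h perLevel ⟩
      ∑ h (λ i → 2 * ∑ E λ z → ∑ (P i) λ x → block * ys i z x)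
        ≡⟨ trans (∑-*ˡ h 2 _) (cong (2 *_) (trans (∑-cong h λ i _ → pull i) (∑-*ˡ h block _))) ⟩
      2 * (block * ∑ h λ i → ∑ E λ z → ∑ (P i) λ x → ys i z x)
        ≡⟨ cong (λ t → 2 * (block * t)) (sym tsum-swap) ⟩
      2 * (block * ∑ range tsum) ∎
      where
      open ≤-Reasoning
      ys : ℕ → ℕ → ℕ → ℕ
      ys i z x = ∑ (R i) λ y → ∑ range λ b → 𝟙 (rep? i z x y b)
      pull : ∀ i → (∑ E λ z → ∑ (P i) λ x → block * ys i z x) ≡ block * (∑ E λ z → ∑ (P i) λ x → ys i z x)
      pull i = trans (∑-cong E λ z _ → ∑-*ˡ (P i) block (ys i z)) (∑-*ˡ E block _)
      cops : ℕ → ℕ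
      cops i = ∑ E λ z → ∑ (P i) λ x → 𝟙 (coprime? (E + z) (γ F (P i) x))
      alg₁ : ∀ E P R → E * (P * R) ≡ R * (E * P)
      alg₁ = solve-∀
      alg₂ : ∀ R c → R * (2 * c) ≡ 2 * (R * c)
      alg₂ = solve-∀
      perLevel : ∀ i → i < h → E * T ≤ 2 * ∑ E λ z → ∑ (P i) λ x → block * ys i z x
      perLevel i i<h = begin
        E * T              ≡⟨ cong (E *_) (sym (PR≡T i<h)) ⟩
        E * (P i * R i)    ≡⟨ alg₁ E (P i) (R i) ⟩
        R i * (E * P i)
          ≤⟨ *-monoʳ-≤ (R i) (coprime-pairs w E (P i) (P i * P i * F) w-divisible (≤-trans (*-monoˡ-≤ E (m≤m+n 2 4)) (6E≤P i))) ⟩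
        R i * (2 * cops i) ≡⟨ alg₂ (R i) (cops i) ⟩
        2 * (R i * cops i)
          ≡⟨ cong (2 *_) (trans (sym (∑-*ˡ E (R i) _)) (∑-cong E λ z _ → sym (∑-*ˡ (P i) (R i) _))) ⟩
        2 * (∑ E λ z → ∑ (P i) λ x → R i * 𝟙 (coprime? (E + z) (γ F (P i) x)))
          ≤⟨ *-monoʳ-≤ 2 (∑-mono E λ z z<E → ∑-mono (P i) λ x x<P → solutions i<h z<E x<P) ⟩
        2 * (∑ E λ z → ∑ (P i) λ x → block * ys i z x) ∎

  -- Dividing h E T by 2 `block` = 4 E^2 F leaves F Δ / 4, because h = F^2 and T = E Δ. No b is
  -- counted twice, by `tsum≤1`.
  candidates : {Cov : ℕ → Set} (cov? : ∀ b → Dec (Cov b)) →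
    (∀ {i z x y b} → InBox i z x y → Rep i z x y b → Cov b) →
    F * Δ ≤ 4 * ∑ range (λ b → 𝟙 (cov? b))
  candidates {Cov} cov? covers = *-cancelˡ-≤ (E * E * F) {{m*n≢0 (E * E) F {{m*n≢0 E E}}}} (begin
    E * E * F * (F * Δ)            ≡⟨ alg₁ E F Δ ⟩
    F * F * (E * (E * Δ))          ≡⟨ cong₂ (λ k t → k * (E * t)) (sym h≡) (trans (sym (^-distribˡ-+-* 2 e δ)) (cong (2 ^_) e+δ≡s)) ⟩
    h * (E * T)                    ≤⟨ many ⟩
    2 * (block * ∑ range tsum)     ≡⟨ alg₂ (E * E * F) (∑ range tsum) ⟩
    E * E * F * (4 * ∑ range tsum) ≤⟨ *-monoʳ-≤ (E * E * F) (*-monoʳ-≤ 4 (∑-mono range λ b _ → atMost b)) ⟩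
    E * E * F * (4 * ∑ range (λ b → 𝟙 (cov? b))) ∎)
    where
    open ≤-Reasoning
    alg₁ : ∀ E F Δ → E * E * F * (F * Δ) ≡ F * F * (E * (E * Δ))
    alg₁ = solve-∀
    alg₂ : ∀ u t → 2 * (2 * u * t) ≡ u * (4 * t)
    alg₂ = solve-∀
    covered : ∀ {b} → (∃[ i ] ∃[ z ] ∃[ x ] ∃[ y ] InBox i z x y × Rep i z x y b) → Cov b
    covered (i , z , x , y , box , r) = covers {i} {z} {x} {y} box r
    atMost : ∀ b → tsum b ≤ 𝟙 (cov? b)
    atMost b with cov? b
    ... | yes _ = tsum≤1 b
    ... | no ¬c = ≮⇒≥ λ pos → ¬c (covered (tsum-pos {b} pos))

  -- n is at least 8 w T^2 F^2 and c d takes at most 2 w T^2 F^2 of it; the rest is a b, with a at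
  -- most 2 E^2 F.
  b-lower : ∀ {i z x y b} → InBox i z x y → Rep i z x y b → Δ * Δ * F ≤ b
  b-lower {i} {z} {x} {y} {b} (i<h , z<E , x<P , y<R) r =
    *-cancelˡ-≤ (2 * w * (E * E * F)) {{m*n≢0 (2 * w) (E * E * F) {{m*n≢0 2 w}} {{m*n≢0 (E * E) F {{m*n≢0 E E}}}}}} (begin
      2 * w * (E * E * F) * (Δ * Δ * F)      ≡⟨ alg₁ w E Δ F ⟩
      2 * (w * (E * Δ * (E * Δ) * (F * F)))  ≡⟨ cong (λ t → 2 * (w * (t * t * (F * F)))) (trans (sym (^-distribˡ-+-* 2 e δ)) (cong (2 ^_) e+δ≡s)) ⟩
      2 * bulk T                             ≤⟨ *-monoˡ-≤ (bulk T) (m≤m+n 2 4) ⟩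
      6 * bulk T                             ≤⟨ big ⟩
      α F E z * b                            ≤⟨ *-monoˡ-≤ b (α≤block z<E) ⟩
      2 * (E * E * F) * b                    ≤⟨ *-monoˡ-≤ b (*-monoˡ-≤ (E * E * F) (m≤m*n 2 w)) ⟩
      2 * w * (E * E * F) * b                ∎)
    where
    open ≤-Reasoning
    alg₁ : ∀ w E Δ F → 2 * w * (E * E * F) * (Δ * Δ * F) ≡ 2 * (w * (E * Δ * (E * Δ) * (F * F)))
    alg₁ = solve-∀
    alg₂ : ∀ w t → 6 * (w * t) + 2 * (w * t) ≡ 8 * w * t
    alg₂ = solve-∀
    big : 6 * bulk T ≤ α F E z * b
    big = +-cancelʳ-≤ (2 * bulk T) _ _ (begin
      6 * bulk T + 2 * bulk T                ≡⟨ alg₂ w (T * T * (F * F)) ⟩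
      8 * w * (T * T * (F * F))              ≤⟨ *-monoˡ-≤ (T * T * (F * F)) 8w≤V ⟩
      V * (T * T * (F * F))                  ≤⟨ n-lower ⟩
      n                                      ≡⟨ r ⟩
      α F E z * b + γ F (P i) x * η F (R i) y
        ≤⟨ +-monoʳ-≤ (α F E z * b) (γη-upper₂ E (P i) (R i) x y (6E≤P i) (P≤R i<h) x<P (<⇒≤ y<R)) ⟩
      α F E z * b + 2 * bulk (P i * R i)     ≡⟨ cong (λ t → α F E z * b + 2 * t) (bulk≡ i<h) ⟩
      α F E z * b + 2 * bulk T               ∎)

-- One stage: explicit elements and greedily chosen b

module Stage (w ω V D q h L : ℕ) .{{_ : NonZero w}}
  (w-divisible : ∀ m → 0 < m → m < 13 → m ∣ w) (2w≤2^ω : 2 * w ≤ 2 ^ ω) (8w≤V : 8 * w ≤ V)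
  (h≡ : h ≡ 2 ^ q * 2 ^ q) (q≤h : q ≤ h) (few : 2 ^ L * 2 ^ L < 2 ^ (D * h))
  where

  open Elements w

  private
    F = 2 ^ q
    N = 2 ^ L * 2 ^ L

    instance
      F≢0 : NonZero F
      F≢0 = m^n≢0 2 q
      V≢0 : NonZero V
      V≢0 = >-nonZero (≤-trans (>-nonZero⁻¹ (8 * w) {{m*n≢0 8 w}}) 8w≤V)

  floor : ℕ → ℕ
  floor k = 2 ^ k * 2 ^ k * F

  explicit : ℕ → List ℕ
  explicit k = applyUpTo (α F (2 ^ k)) (2 ^ k) ++ applyUpTo (γ F (2 ^ k)) (2 ^ k) ++ applyUpTo (η F (2 ^ k)) (2 ^ k)

  α∈ : ∀ k {z} → z < 2 ^ k → α F (2 ^ k) z ∈ explicit k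
  α∈ k z< = ∈-++⁺ˡ (∈-applyUpTo⁺ (α F (2 ^ k)) z<)

  γ∈ : ∀ k {x} → x < 2 ^ k → γ F (2 ^ k) x ∈ explicit k
  γ∈ k x< = ∈-++⁺ʳ (applyUpTo (α F (2 ^ k)) (2 ^ k)) (∈-++⁺ˡ (∈-applyUpTo⁺ (γ F (2 ^ k)) x<))

  η∈ : ∀ k {y} → y < 2 ^ k → η F (2 ^ k) y ∈ explicit k
  η∈ k y< = ∈-++⁺ʳ (applyUpTo (α F (2 ^ k)) (2 ^ k)) (∈-++⁺ʳ (applyUpTo (γ F (2 ^ k)) (2 ^ k)) (∈-applyUpTo⁺ (η F (2 ^ k)) y<))

  private
    explicits : List ℕ
    explicits = concat (applyUpTo explicit L)

    ∈-explicits : ∀ {k x} → k < L → x ∈ explicit k → x ∈ explicits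
    ∈-explicits k<L x∈ = ∈-concat⁺′ x∈ (∈-applyUpTo⁺ explicit k<L)

    scale : ℕ → ℕ
    scale s = 2 ^ s * 2 ^ s * (F * F)

    Window : ℕ → ℕ → Set
    Window s n = 6 * h + 6 + ω ≤ s × s < L × V * scale s ≤ n × n < 4 * V * scale s

    window? : ∀ s n → Dec (Window s n)
    window? s n = (6 * h + 6 + ω ≤? s) ×-dec (s <? L) ×-dec (V * scale s ≤? n) ×-dec (n <? 4 * V * scale s)

    -- If n lies in the window of s, then the levels s - e with e < h are active: h separate chances
    -- to cover n.
    Active : ℕ → ℕ → Set
    Active δ n = ∃[ e ] e < h × Window (e + δ) n

    active? : ∀ δ n → Dec (Active δ n)
    active? δ n = anyUpTo? (λ e → window? (e + δ) n) h

    -- The bound `floor δ ≤ b` is part of covering, so that every b that is put to use satisfies the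
    -- size condition in `Member`, on which the counting relies.
    Cov : ℕ → ℕ → ℕ → Set
    Cov δ n b = floor δ ≤ b × Any (λ a → Any (λ c → Any (λ d → n ≡ a * b + c * d) explicits) explicits) explicits

    cov? : ∀ δ n b → Dec (Cov δ n b)
    cov? δ n b = (floor δ ≤? b) ×-dec any? (λ a → any? (λ c → any? (λ d → n ≟ a * b + c * d) explicits) explicits) explicits

    range : ℕ → ℕ
    range δ = 4 * V * floor δ

    -- The length 4 V 4^δ F of the range divided by the F 2^δ / 4 candidates that `candidates`
    -- guarantees.
    rate : ℕ → ℕ
    rate δ = 16 * V * 2 ^ δ

    2≤rate : ∀ δ → 2 ≤ rate δ
    2≤rate δ = ≤-trans (m≤m+n 2 14) (≤-trans (m≤m*n 16 V) (m≤m*n (16 * V) (2 ^ δ) {{m^n≢0 2 δ}}))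

    suc-pred-rate : ∀ δ → suc (pred (rate δ)) ≡ rate δ
    suc-pred-rate δ = suc-pred (rate δ) {{>-nonZero (≤-trans (n≤1+n 1) (2≤rate δ))}}

    range>0 : ∀ δ → 0 < range δ
    range>0 δ = >-nonZero⁻¹ (range δ)
      {{m*n≢0 (4 * V) (floor δ) {{m*n≢0 4 V}} {{m*n≢0 (2 ^ δ * 2 ^ δ) F {{m*n≢0 (2 ^ δ) (2 ^ δ) {{m^n≢0 2 δ}} {{m^n≢0 2 δ}}}}}}}}

    dense : ∀ δ n → n < N → Active δ n → range δ ≤ suc (pred (rate δ)) * ∑ (range δ) (λ b → 𝟙 (cov? δ n b))
    dense δ n _ (e , e<h , s-large , s<L , lower , upper) = begin
      range δ                              ≡⟨ alg₁ V (2 ^ δ) F ⟩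
      4 * V * 2 ^ δ * (F * 2 ^ δ)          ≤⟨ *-monoʳ-≤ (4 * V * 2 ^ δ) (C.candidates (cov? δ n) λ {i} {z} {x} {y} {b} → covers {i} {z} {x} {y} {b}) ⟩
      4 * V * 2 ^ δ * (4 * hits)          ≡⟨ alg₂ V (2 ^ δ) hits ⟩
      rate δ * hits                       ≡⟨ cong (_* hits) (sym (suc-pred-rate δ)) ⟩
      suc (pred (rate δ)) * hits          ∎
      where
      open ≤-Reasoning
      module C = Candidates w ω V q h (e + δ) e δ n w-divisible 2w≤2^ω 8w≤V h≡ q≤h e<h refl s-large lower upper
      hits = ∑ (range δ) (λ b → 𝟙 (cov? δ n b))
      alg₁ : ∀ V Δ F → 4 * V * (Δ * Δ * F) ≡ 4 * V * Δ * (F * Δ)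
      alg₁ = solve-∀
      alg₂ : ∀ V Δ c → 4 * V * Δ * (4 * c) ≡ 16 * V * Δ * c
      alg₂ = solve-∀
      covers : ∀ {i z x y b} → C.InBox i z x y → C.Rep i z x y b → Cov δ n b
      covers {i} {z} {x} {y} {b} box@(i<h , z<E , x<P , y<R) r = C.b-lower {i} {z} {x} {y} {b} box r ,
        lose (∈-explicits e<L (α∈ e z<E))
          (lose (∈-explicits (≤-trans (s≤s (C.cLevel≤s i<h)) s<L) (γ∈ (C.cLevel i) x<P))
            (lose (∈-explicits (≤-trans (s≤s (m∸n≤m (e + δ) (C.cLevel i))) s<L) (η∈ (C.dLevel i) y<R))
              r))
        where
        e<L : e < L
        e<L = ≤-trans (s≤s (m≤m+n e δ)) s<L

    module G = Cover N D range (λ δ → pred (rate δ)) range>0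
      (λ δ → >-nonZero (s≤s⁻¹ (≤-trans (2≤rate δ) (≤-reflexive (sym (suc-pred-rate δ))))))
      cov? active? dense

  level : ℕ → List ℕ
  level k = explicit k ++ G.family k

  length-level : ∀ k → length (level k) ≡ (3 + 16 * V * D) * 2 ^ k
  length-level k = begin
    length (level k)
      ≡⟨ length-++ (explicit k) ⟩
    length (explicit k) + length (G.family k)
      ≡⟨ cong₂ _+_ (trans (length-++ (applyUpTo (α F (2 ^ k)) (2 ^ k))) (cong₂ _+_ (length-applyUpTo (α F (2 ^ k)) (2 ^ k))
           (trans (length-++ (applyUpTo (γ F (2 ^ k)) (2 ^ k))) (cong₂ _+_ (length-applyUpTo (γ F (2 ^ k)) (2 ^ k)) (length-applyUpTo (η F (2 ^ k)) (2 ^ k))))))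
         (trans (G.length-family k) (cong (_* D) (suc-pred-rate k))) ⟩
    2 ^ k + (2 ^ k + 2 ^ k) + 16 * V * 2 ^ k * D
      ≡⟨ alg V D (2 ^ k) ⟩
    (3 + 16 * V * D) * 2 ^ k ∎
    where
    open ≡-Reasoning
    alg : ∀ V D p → p + (p + p) + 16 * V * p * D ≡ (3 + 16 * V * D) * p
    alg = solve-∀

  Member : ℕ → Set
  Member x = ∃[ k ] k < L × floor k ≤ x × x ∈ level k

  private
    α-floor : ∀ k z → floor k ≤ α F (2 ^ k) z
    α-floor k z = ≤-trans (≤-reflexive (alg (2 ^ k) F)) (*-monoʳ-≤ (2 ^ k * F) (m≤m+n (2 ^ k) z))
      where
      alg : ∀ p f → p * p * f ≡ p * f * p
      alg = solve-∀

    γ-floor : ∀ k x → floor k ≤ γ F (2 ^ k) x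
    γ-floor k x = ≤-trans (≤-trans (m≤m+n (floor k) x) (m≤n*m (floor k + x) w)) (m≤m+n _ 1)

    applyUpTo-floor : ∀ k (f : ℕ → ℕ) → (∀ t → floor k ≤ f t) → ∀ {x} → x ∈ applyUpTo f (2 ^ k) → floor k ≤ x
    applyUpTo-floor k f f≥ x∈ = let t , _ , eq = ∈-applyUpTo⁻ f x∈ in ≤-trans (f≥ t) (≤-reflexive (sym eq))

    explicit-floor : ∀ k {x} → x ∈ explicit k → floor k ≤ x
    explicit-floor k = [ applyUpTo-floor k (α F (2 ^ k)) (α-floor k)
      , [ applyUpTo-floor k (γ F (2 ^ k)) (γ-floor k)
        , applyUpTo-floor k (η F (2 ^ k)) (λ y → m≤m+n (floor k) y) ]′ ∘ ∈-++⁻ (applyUpTo (γ F (2 ^ k)) (2 ^ k)) ]′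
      ∘ ∈-++⁻ (applyUpTo (α F (2 ^ k)) (2 ^ k))

    explicit-member : ∀ {x} → x ∈ explicits → Member x
    explicit-member {x} x∈ =
      let l , x∈l , l∈ = ∈-concat⁻′ (applyUpTo explicit L) x∈
          k , k<L , eq = ∈-applyUpTo⁻ explicit l∈
          x∈k = subst (x ∈_) eq x∈l
      in k , k<L , explicit-floor k x∈k , ∈-++⁺ˡ x∈k

    active-count : ∀ s n → Window s n → h ≤ ∑ L (λ δ → 𝟙 (active? δ n))
    active-count s n win@(s-large , s<L , _) = begin
      h                                            ≡⟨ sym (trans (∑-const h 1) (*-identityʳ h)) ⟩
      ∑ h (λ _ → 1)                                ≤⟨ ∑-mono h (λ j j<h → ≤-reflexive (sym (𝟙-yes (active? (lo + j) n) (active j j<h)))) ⟩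
      ∑ h (λ j → f (lo + j))                       ≤⟨ m≤n+m _ (∑ lo f) ⟩
      ∑ lo f + ∑ h (λ j → f (lo + j))              ≡⟨ sym (∑-split lo h f) ⟩
      ∑ (lo + h) f                                 ≤⟨ ∑-monoˡ f (≤-trans (≤-reflexive lo+h) s<L) ⟩
      ∑ L f                                        ∎
      where
      open ≤-Reasoning
      f : ℕ → ℕ
      f δ = 𝟙 (active? δ n)
      -- The active levels found here are s - h + 1, ..., s; `lo` is the first of them, and level lo
      -- + j belongs to e = h - 1 - j.
      lo = suc s ∸ h
      lo+h : lo + h ≡ suc s
      lo+h = m∸n+n≡m (≤-trans (≤-trans (m≤m+n h (5 * h + 6 + ω)) (≤-trans (≤-reflexive (alg h ω)) s-large)) (n≤1+n s))
        where
        alg : ∀ h ω → h + (5 * h + 6 + ω) ≡ 6 * h + 6 + ω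
        alg = solve-∀
      active : ∀ j → j < h → Active (lo + j) n
      active j j<h = h ∸ suc j , m∸1+n<m , subst (λ t → Window t n) (sym (suc-injective eq)) win
        where
        m∸1+n<m : h ∸ suc j < h
        m∸1+n<m = ∸-monoʳ-< z<s j<h
        alg : ∀ e l j → suc (e + (l + j)) ≡ l + (e + suc j)
        alg = solve-∀
        eq : suc (h ∸ suc j + (lo + j)) ≡ suc s
        eq = trans (alg (h ∸ suc j) lo j) (trans (cong (lo +_) (m∸n+n≡m j<h)) lo+h)

  -- The active levels would raise the weight of an uncovered n to at least 2^(D h), which exceeds
  -- the number 4^L of all n in question.
  represent : ∀ s n → 6 * h + 6 + ω ≤ s → s < L → V * (2 ^ s * 2 ^ s * (F * F)) ≤ n → n < 4 * V * (2 ^ s * 2 ^ s * (F * F)) →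
    n < 2 ^ L * 2 ^ L → ∃[ a ] ∃[ b ] ∃[ c ] ∃[ d ] Member a × Member b × Member c × Member d × n ≡ a * b + c * d
  represent s n s-large s<L lower upper n<N
    = unpack (G.covered L n n<N (≤-trans few (^-monoʳ-≤ 2 (*-monoʳ-≤ D (active-count s n (s-large , s<L , lower , upper))))))
    where
    unpack : (∃[ δ ] δ < L × Any (Cov δ n) (G.family δ)) →
      ∃[ a ] ∃[ b ] ∃[ c ] ∃[ d ] Member a × Member b × Member c × Member d × n ≡ a * b + c * d
    unpack (δ , δ<L , cov) =
      let b , b∈ , b≥ , any₁ = find cov
          a , a∈ , any₂ = find any₁
          c , c∈ , any₃ = find any₂
          d , d∈ , eq = find any₃
      in a , b , c , d , explicit-member a∈ , (δ , δ<L , b≥ , ∈-++⁺ʳ (explicit δ) b∈) , explicit-member c∈ , explicit-member d∈ , eq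

-- Counting by indicators, sums of powers of two, logarithms

length-filter : ∀ {P : Pred ℕ 0ℓ} (P? : Decidable P) (f : ℕ → ℕ) n →
  length (filter P? (applyUpTo f n)) ≡ ∑ n (λ i → 𝟙 (P? (f i)))
length-filter P? f zero    = refl
length-filter P? f (suc n) with ih ← length-filter P? (f ∘ suc) n | P? (f 0) in eq
... | yes _ = trans (cong suc ih) (sym (trans (∑-split 1 n (λ i → 𝟙 (P? (f i)))) (cong (λ d → 𝟙 d + ∑ n (λ i → 𝟙 (P? (f (suc i))))) eq)))
... | no _  = trans ih (sym (trans (∑-split 1 n (λ i → 𝟙 (P? (f i)))) (cong (λ d → 𝟙 d + ∑ n (λ i → 𝟙 (P? (f (suc i))))) eq)))

∑-𝟙< : ∀ n m → ∑ n (λ i → 𝟙 (i <? m)) ≤ m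
∑-𝟙< zero    m = z≤n
∑-𝟙< (suc n) m with n <? m
... | no _    = ≤-trans (≤-reflexive (+-identityʳ _)) (∑-𝟙< n m)
... | yes n<m = ≤-trans (+-monoˡ-≤ 1 (≤-trans (∑-mono n λ i _ → 𝟙≤1 (i <? m)) (≤-reflexive (trans (∑-const n 1) (*-identityʳ n)))))
                  (≤-trans (≤-reflexive (+-comm n 1)) n<m)

∑-∈ : ∀ n (xs : List ℕ) → ∑ n (λ i → 𝟙 (suc i ∈? xs)) ≤ length xs
∑-∈ n []       = ≤-reflexive (trans (∑-cong n λ i _ → 𝟙-no (suc i ∈? []) λ ()) (trans (∑-const n 0) (*-zeroʳ n)))
∑-∈ n (x ∷ xs) = begin
  ∑ n (λ i → 𝟙 (suc i ∈? (x ∷ xs)))                            ≤⟨ ∑-mono n (λ i _ → split i) ⟩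
  ∑ n (λ i → 𝟙 (suc i ≟ x) + 𝟙 (suc i ∈? xs))                  ≡⟨ ∑-+ n _ _ ⟩
  ∑ n (λ i → 𝟙 (suc i ≟ x)) + ∑ n (λ i → 𝟙 (suc i ∈? xs))      ≤⟨ +-mono-≤ once (∑-∈ n xs) ⟩
  suc (length xs)                                              ∎
  where
  open ≤-Reasoning
  split : ∀ i → 𝟙 (suc i ∈? (x ∷ xs)) ≤ 𝟙 (suc i ≟ x) + 𝟙 (suc i ∈? xs)
  split i with suc i ∈? (x ∷ xs)
  ... | no _          = z≤n
  ... | yes (here p)  = ≤-trans (≤-reflexive (sym (𝟙-yes (suc i ≟ x) p))) (m≤m+n _ _)
  ... | yes (there p) = ≤-trans (≤-reflexive (sym (𝟙-yes (suc i ∈? xs) p))) (m≤n+m _ _)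
  once : ∑ n (λ i → 𝟙 (suc i ≟ x)) ≤ 1
  once = ∑-atMostOne n _ (λ i _ → 𝟙≤1 (suc i ≟ x)) λ i j _ _ p q →
    suc-injective (trans (𝟙-pos⇒ (suc i ≟ x) p) (sym (𝟙-pos⇒ (suc j ≟ x) q)))

∑-2^< : ∀ n → suc (∑ n (2 ^_)) ≡ 2 ^ n
∑-2^< zero    = refl
∑-2^< (suc n) = trans (cong (_+ 2 ^ n) (∑-2^< n)) (cong (2 ^ n +_) (sym (+-identityʳ _)))

∑-𝟙<-2^ : ∀ n r → ∑ n (λ k → 𝟙 (k <? r) * 2 ^ k) < 2 ^ r
∑-𝟙<-2^ zero    r = m^n>0 2 r
∑-𝟙<-2^ (suc n) r with n <? r
... | no _    = ≤-trans (s≤s (≤-reflexive (+-identityʳ _))) (∑-𝟙<-2^ n r)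
... | yes n<r = begin
  suc (∑ n (λ k → 𝟙 (k <? r) * 2 ^ k) + (2 ^ n + 0)) ≤⟨ +-mono-≤ (s≤s (∑-mono n λ k _ → ≤-trans (*-monoˡ-≤ (2 ^ k) (𝟙≤1 (k <? r))) (≤-reflexive (*-identityˡ _)))) ≤-refl ⟩
  suc (∑ n (2 ^_)) + (2 ^ n + 0)                     ≡⟨ cong (_+ (2 ^ n + 0)) (∑-2^< n) ⟩
  2 ^ suc n                                          ≤⟨ ^-monoʳ-≤ 2 n<r ⟩
  2 ^ r                                              ∎
  where open ≤-Reasoning

geometric : ∀ n B (g : ℕ → ℕ) → (∀ j → j < n → 2 ^ j * g j ≤ B) → ∑ n g ≤ 2 * B
geometric n B g h = *-cancelˡ-≤ (2 ^ n) {{m^n≢0 2 n}} (m+n≤o⇒m≤o _ (strong n ≤-refl))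
  where
  open ≤-Reasoning
  alg₁ : ∀ p s t B → 2 * p * (s + t) + 2 * B ≡ 2 * (p * s) + 2 * (p * t) + 2 * B
  alg₁ = solve-∀
  alg₂ : ∀ u B → 2 * u + 2 * B + 2 * B ≡ 2 * (u + 2 * B)
  alg₂ = solve-∀
  -- Strengthened for the induction: the first k terms sum to at most 2B (1 - 2^(-k)).
  strong : ∀ k → k ≤ n → 2 ^ k * ∑ k g + 2 * B ≤ 2 ^ k * (2 * B)
  strong zero    _   = ≤-reflexive (sym (*-identityˡ _))
  strong (suc k) k<n = begin
    2 * 2 ^ k * (∑ k g + g k) + 2 * B                    ≡⟨ alg₁ (2 ^ k) (∑ k g) (g k) B ⟩
    2 * (2 ^ k * ∑ k g) + 2 * (2 ^ k * g k) + 2 * B      ≤⟨ +-monoˡ-≤ (2 * B) (+-monoʳ-≤ (2 * (2 ^ k * ∑ k g)) (*-monoʳ-≤ 2 (h k k<n))) ⟩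
    2 * (2 ^ k * ∑ k g) + 2 * B + 2 * B                  ≡⟨ alg₂ (2 ^ k * ∑ k g) B ⟩
    2 * (2 ^ k * ∑ k g + 2 * B)                          ≤⟨ *-monoʳ-≤ 2 (strong k (<⇒≤ k<n)) ⟩
    2 * (2 ^ k * (2 * B))                                ≡⟨ sym (*-assoc 2 (2 ^ k) (2 * B)) ⟩
    2 * 2 ^ k * (2 * B)                                  ∎

∑-2^∘ : ∀ n (r : ℕ → ℕ) → (∀ i → r i < r (suc i)) → ∑ (suc n) (λ i → 2 ^ r i) ≤ 2 ^ suc (r n)
∑-2^∘ zero    r inc = m≤m+n _ _
∑-2^∘ (suc n) r inc = begin
  ∑ (suc n) (λ i → 2 ^ r i) + 2 ^ r (suc n)    ≤⟨ +-monoˡ-≤ _ (≤-trans (∑-2^∘ n r inc) (^-monoʳ-≤ 2 (inc n))) ⟩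
  2 ^ r (suc n) + 2 ^ r (suc n)                ≡⟨ cong (2 ^ r (suc n) +_) (sym (+-identityʳ _)) ⟩
  2 ^ suc (r (suc n))                          ∎
  where open ≤-Reasoning

least : ∀ {P : Pred ℕ 0ℓ} → Decidable P → ∀ n → P n → ∃[ p ] P p × (∀ q → q < p → ¬ P q)
least {P} P? n Pn = [ (λ none → n , Pn , none) , id ]′ (below n)
  where
  below : ∀ n → (∀ q → q < n → ¬ P q) ⊎ (∃[ p ] P p × (∀ q → q < p → ¬ P q))
  below zero = inj₁ λ _ ()
  below (suc n) with below n
  ... | inj₂ found = inj₂ found
  ... | inj₁ none with P? n
  ...   | yes Pn = inj₂ (n , Pn , none)
  ...   | no ¬Pn = inj₁ λ q q≤n Pq → [ (λ q<n → none q q<n Pq) , (λ { refl → ¬Pn Pq }) ]′ (m≤n⇒m<n∨m≡n (s≤s⁻¹ q≤n))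

n<2^n : ∀ n → n < 2 ^ n
n<2^n zero    = z<s
n<2^n (suc n) = begin
  suc (suc n)     ≤⟨ s≤s (n<2^n n) ⟩
  suc (2 ^ n)     ≤⟨ +-monoˡ-≤ (2 ^ n) (m^n>0 2 n) ⟩
  2 ^ n + 2 ^ n   ≡⟨ cong (2 ^ n +_) (sym (+-identityʳ _)) ⟩
  2 ^ suc n       ∎
  where open ≤-Reasoning

sq-mono-≤ : ∀ {m n} → m ≤ n → m * m ≤ n * n
sq-mono-≤ m≤n = *-mono-≤ m≤n m≤n

sq-cancel-< : ∀ {m n} → m * m < n * n → m < n
sq-cancel-< m²<n² = ≰⇒> λ n≤m → <⇒≱ m²<n² (sq-mono-≤ n≤m)

2^-cancel-< : ∀ {m n} → 2 ^ m < 2 ^ n → m < n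
2^-cancel-< 2^m<2^n = ≰⇒> λ n≤m → <⇒≱ 2^m<2^n (^-monoʳ-≤ 2 n≤m)

log₄ : ∀ n → 0 < n → ∃[ t ] 2 ^ t * 2 ^ t ≤ n × n < 2 ^ suc t * 2 ^ suc t
log₄ n n>0 = bracket (least (λ t → n <? 2 ^ suc t * 2 ^ suc t) n
  (≤-trans (≤-trans (n<2^n n) (^-monoʳ-≤ 2 (n≤1+n n))) (m≤m*n (2 ^ suc n) (2 ^ suc n) {{m^n≢0 2 (suc n)}})))
  where
  bracket : (∃[ t ] n < 2 ^ suc t * 2 ^ suc t × (∀ u → u < t → ¬ n < 2 ^ suc u * 2 ^ suc u)) →
    ∃[ t ] 2 ^ t * 2 ^ t ≤ n × n < 2 ^ suc t * 2 ^ suc t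
  bracket (zero  , n< , _) = 0 , n>0 , n<
  bracket (suc t , n< , ¬n<) = suc t , ≮⇒≥ (¬n< t ≤-refl) , n<

-- The union of the stages and its counting function

-- This is 16^Q, written as the square of F = 2^(Q + Q), the form in which a stage needs h.
height : ℕ → ℕ
height Q = 2 ^ (Q + Q) * 2 ^ (Q + Q)

height-suc : ∀ Q → height (suc Q) ≡ 16 * height Q
height-suc Q = trans (cong (λ t → 2 ^ suc t * 2 ^ suc t) (+-suc Q Q)) (alg (2 ^ (Q + Q)))
  where
  alg : ∀ p → 2 * (2 * p) * (2 * (2 * p)) ≡ 16 * (p * p)
  alg = solve-∀

height>0 : ∀ Q → 0 < height Q
height>0 Q = *-mono-≤ (m^n>0 2 (Q + Q)) (m^n>0 2 (Q + Q))

2Q≤height : ∀ Q → Q + Q ≤ height Q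
2Q≤height Q = ≤-trans (<⇒≤ (n<2^n (Q + Q))) (m≤m*n (2 ^ (Q + Q)) (2 ^ (Q + Q)) {{m^n≢0 2 (Q + Q)}})

-- p is the least stage whose levels reach up to X, so that 2^p is of order (log X)^{1/4}.
module Assemble (κ K : ℕ) .{{_ : NonZero κ}} (level : ℕ → ℕ → List ℕ)
  (length-level : ∀ Q k → length (level Q k) ≤ K * 2 ^ k)
  where

  -- Equal to `κ * height (suc Q)`, the value of log₄ n at which the next stage takes over.
  top : ℕ → ℕ
  top Q = 16 * κ * height Q

  floor : ℕ → ℕ → ℕ
  floor Q k = 2 ^ k * 2 ^ k * 2 ^ (Q + Q)

  Entry : ℕ → ℕ → ℕ → Set
  Entry Q k x = k < top Q × floor Q k ≤ x × x ∈ level Q k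

  entry? : ∀ Q k x → Dec (Entry Q k x)
  entry? Q k x = (k <? top Q) ×-dec (floor Q k ≤? x) ×-dec (x ∈? level Q k)

  initial : ℕ
  initial = 2 ^ κ * 2 ^ κ

  -- Bounding Q and k by x makes membership a finite search. Nothing is lost, since `floor Q k ≤ x`
  -- implies both bounds.
  A : Pred ℕ 0ℓ
  A x = x < initial ⊎ (∃[ Q ] Q < suc x × ∃[ k ] k < suc x × Entry Q k x)

  A? : Decidable A
  A? x = (x <? initial) ⊎-dec anyUpTo? (λ Q → anyUpTo? (λ k → entry? Q k x) (suc x)) (suc x)

  private
    open ≤-Reasoning

    instance
      2^≢0 : ∀ {n} → NonZero (2 ^ n)
      2^≢0 {n} = m^n≢0 2 n

    floor-bounds : ∀ Q k {x} → floor Q k ≤ x → Q < suc x × k < suc x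
    floor-bounds Q k {x} fl≤x =
      s≤s (≤-trans (≤-trans (m≤m+n Q Q) (<⇒≤ (n<2^n (Q + Q)))) (≤-trans (m≤n*m (2 ^ (Q + Q)) (2 ^ k * 2 ^ k) {{m*n≢0 (2 ^ k) (2 ^ k) {{2^≢0 {k}}} {{2^≢0 {k}}}}}) fl≤x)) ,
      s≤s (≤-trans (<⇒≤ (n<2^n k)) (≤-trans (≤-trans (m≤m*n (2 ^ k) (2 ^ k) {{2^≢0 {k}}}) (m≤m*n (2 ^ k * 2 ^ k) (2 ^ (Q + Q)) {{2^≢0 {Q + Q}}})) fl≤x))

  entry⇒A : ∀ {Q k x} → Entry Q k x → A x
  entry⇒A {Q} {k} en@(_ , fl≤x , _) = let Q≤x , k≤x = floor-bounds Q k fl≤x in inj₂ (Q , Q≤x , k , k≤x , en)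

  private
    instance
      top≢0 : ∀ {Q} → NonZero (top Q)
      top≢0 {Q} = m*n≢0 (16 * κ) (height Q) {{m*n≢0 16 κ}} {{>-nonZero (height>0 Q)}}

    top-inc : ∀ Q → top Q < top (suc Q)
    top-inc Q = *-monoʳ-< (16 * κ) {{m*n≢0 16 κ}} (≤-trans (m<m*n (height Q) 16 {{>-nonZero (height>0 Q)}} (s≤s (s≤s z≤n)))
      (≤-reflexive (trans (*-comm (height Q) 16) (sym (height-suc Q)))))

    module _ (X v : ℕ) (v-lower : 2 ^ v * 2 ^ v ≤ X) (v-upper : X < 2 ^ suc v * 2 ^ suc v) where

      fits? : ∀ Q k → Dec (k < top Q × k + Q ≤ v)
      fits? Q k = (k <? top Q) ×-dec (k + Q ≤? v)

      floor-fits : ∀ Q k → floor Q k ≤ X → k + Q ≤ v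
      floor-fits Q k fl≤X = s≤s⁻¹ (2^-cancel-< {k + Q} {suc v} (sq-cancel-< (begin-strict
        2 ^ (k + Q) * 2 ^ (k + Q)          ≡⟨ cong (λ t → t * t) (^-distribˡ-+-* 2 k Q) ⟩
        2 ^ k * 2 ^ Q * (2 ^ k * 2 ^ Q)    ≡⟨ alg (2 ^ k) (2 ^ Q) ⟩
        2 ^ k * 2 ^ k * (2 ^ Q * 2 ^ Q)    ≡⟨ cong (2 ^ k * 2 ^ k *_) (sym (^-distribˡ-+-* 2 Q Q)) ⟩
        floor Q k                          ≤⟨ fl≤X ⟩
        X                                  <⟨ v-upper ⟩
        2 ^ suc v * 2 ^ suc v              ∎)))
        where
        alg : ∀ a b → a * b * (a * b) ≡ a * a * (b * b)
        alg = solve-∀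

      inner : ℕ → ℕ
      inner Q = ∑ (suc X) λ k → 𝟙 (fits? Q k) * 2 ^ k

      inner-top : ∀ Q → inner Q ≤ 2 ^ top Q
      inner-top Q = ≤-trans (∑-mono (suc X) λ k _ → *-monoˡ-≤ (2 ^ k) (𝟙-mono (fits? Q k) (k <? top Q) proj₁)) (<⇒≤ (∑-𝟙<-2^ (suc X) (top Q)))

      inner-size : ∀ Q → 2 ^ Q * inner Q ≤ 2 ^ suc v
      inner-size Q with Q ≤? suc v
      ... | yes Q≤ = begin
        2 ^ Q * inner Q              ≤⟨ *-monoʳ-≤ (2 ^ Q) (≤-trans (∑-mono (suc X) λ k _ → *-monoˡ-≤ (2 ^ k) (𝟙-mono (fits? Q k) (k <? suc v ∸ Q) λ (_ , fit) →
                                          m+n≤o⇒m≤o∸n (suc k) (s≤s fit))) (<⇒≤ (∑-𝟙<-2^ (suc X) (suc v ∸ Q)))) ⟩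
        2 ^ Q * 2 ^ (suc v ∸ Q)      ≡⟨ sym (^-distribˡ-+-* 2 Q (suc v ∸ Q)) ⟩
        2 ^ (Q + (suc v ∸ Q))        ≡⟨ cong (2 ^_) (m+[n∸m]≡n Q≤) ⟩
        2 ^ suc v                    ∎
      ... | no Q≰ = ≤-trans (≤-reflexive (trans (cong (2 ^ Q *_) none) (*-zeroʳ (2 ^ Q)))) z≤n
        where
        none : inner Q ≡ 0
        none = trans (∑-cong (suc X) λ k _ → cong (_* 2 ^ k) (𝟙-no (fits? Q k) λ (_ , fit) → Q≰ (≤-trans (m≤n+m Q k) (m≤n⇒m≤1+n fit))))
          (trans (∑-const (suc X) 0) (*-zeroʳ (suc X)))

      entries : ∀ Q k → ∑ X (λ i → 𝟙 (entry? Q k (suc i))) ≤ K * (𝟙 (fits? Q k) * 2 ^ k)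
      entries Q k with fits? Q k
      ... | yes _ = begin
        ∑ X (λ i → 𝟙 (entry? Q k (suc i)))       ≤⟨ ∑-mono X (λ i _ → 𝟙-mono (entry? Q k (suc i)) (suc i ∈? level Q k) (proj₂ ∘ proj₂)) ⟩
        ∑ X (λ i → 𝟙 (suc i ∈? level Q k))       ≤⟨ ∑-∈ X (level Q k) ⟩
        length (level Q k)                       ≤⟨ length-level Q k ⟩
        K * 2 ^ k                                ≡⟨ cong (K *_) (sym (*-identityˡ (2 ^ k))) ⟩
        K * (1 * 2 ^ k)                          ∎
      ... | no ¬fit = ≤-trans (≤-reflexive (trans (∑-cong X λ i i<X → 𝟙-no (entry? Q k (suc i)) λ (k<t , fl≤ , _) →
              ¬fit (k<t , floor-fits Q k (≤-trans fl≤ i<X))) (trans (∑-const X 0) (*-zeroʳ X)))) z≤n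

      count≤ : count A? X ≤ initial + K * ∑ (suc X) inner
      count≤ = begin
        count A? X
          ≡⟨ length-filter A? suc X ⟩
        ∑ X (λ i → 𝟙 (A? (suc i)))
          ≤⟨ ∑-mono X cover ⟩
        ∑ X (λ i → 𝟙 (i <? initial) + ∑ (suc X) λ Q → ∑ (suc X) λ k → 𝟙 (entry? Q k (suc i)))
          ≡⟨ ∑-+ X _ _ ⟩
        ∑ X (λ i → 𝟙 (i <? initial)) + ∑ X (λ i → ∑ (suc X) λ Q → ∑ (suc X) λ k → 𝟙 (entry? Q k (suc i)))
          ≤⟨ +-mono-≤ (∑-𝟙< X initial) (≤-reflexive (trans (∑-swap X (suc X) _) (∑-cong (suc X) λ Q _ → ∑-swap X (suc X) _))) ⟩
        initial + ∑ (suc X) (λ Q → ∑ (suc X) λ k → ∑ X λ i → 𝟙 (entry? Q k (suc i)))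
          ≤⟨ +-monoʳ-≤ initial (∑-mono (suc X) λ Q _ → ∑-mono (suc X) λ k _ → entries Q k) ⟩
        initial + ∑ (suc X) (λ Q → ∑ (suc X) λ k → K * (𝟙 (fits? Q k) * 2 ^ k))
          ≡⟨ cong (initial +_) (trans (∑-cong (suc X) λ Q _ → ∑-*ˡ (suc X) K _) (∑-*ˡ (suc X) K inner)) ⟩
        initial + K * ∑ (suc X) inner ∎
        where
        cover : ∀ i → i < X → 𝟙 (A? (suc i)) ≤ 𝟙 (i <? initial) + ∑ (suc X) λ Q → ∑ (suc X) λ k → 𝟙 (entry? Q k (suc i))
        cover i i<X with A? (suc i)
        ... | no _ = z≤n
        ... | yes (inj₁ small) = ≤-trans (≤-reflexive (sym (𝟙-yes (i <? initial) (≤-trans (n≤1+n (suc i)) small)))) (m≤m+n _ _)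
        ... | yes (inj₂ (Q , Q≤ , k , k≤ , en)) = begin
          1                                        ≡⟨ sym (𝟙-yes (entry? Q k (suc i)) en) ⟩
          𝟙 (entry? Q k (suc i))                   ≤⟨ term≤∑ (λ k → 𝟙 (entry? Q k (suc i))) (≤-trans k≤ (s≤s i<X)) ⟩
          ∑ (suc X) (λ k → 𝟙 (entry? Q k (suc i))) ≤⟨ term≤∑ (λ Q → ∑ (suc X) λ k → 𝟙 (entry? Q k (suc i))) (≤-trans Q≤ (s≤s i<X)) ⟩
          ∑ (suc X) (λ Q → ∑ (suc X) λ k → 𝟙 (entry? Q k (suc i))) ≤⟨ m≤n+m _ (𝟙 (i <? initial)) ⟩
          𝟙 (i <? initial) + ∑ (suc X) (λ Q → ∑ (suc X) λ k → 𝟙 (entry? Q k (suc i))) ∎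

      -- The threshold serves two purposes: for the least such p it gives log X = O(16^p), and its
      -- failure at p - 1 bounds all earlier stages, even when they are counted in full.
      Reaches : ℕ → Set
      Reaches p = v ≤ suc (top p + p)

      module _ (p : ℕ) (reaches : Reaches p) (minimal : ∀ Q → Q < p → ¬ Reaches Q) where

        below-p : ∀ p′ → p ≡ suc p′ → suc (suc (top p′ + p′)) ≤ v
        below-p p′ refl = ≰⇒> (minimal p′ ≤-refl)

        p≤v : p ≤ v
        p≤v = case-p p refl
          where
          case-p : ∀ p′ → p ≡ p′ → p′ ≤ v
          case-p zero     _  = z≤n
          case-p (suc p′) eq = ≤-trans (s≤s (≤-trans (m≤n+m p′ (top p′)) (n≤1+n _))) (below-p p′ eq)

        -- The tops increase strictly, so stages 0, ..., p′ = p - 1 sum to at most 2^(top p′ + 1),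
        -- and the failure of p′ to reach v leaves room for the factor 2^p.
        early : 2 ^ p * ∑ p inner ≤ 2 ^ v
        early = case-p p refl
          where
          alg : ∀ t p → suc p + suc t ≡ suc (suc (t + p))
          alg = solve-∀
          case-p : ∀ p′ → p ≡ p′ → 2 ^ p′ * ∑ p′ inner ≤ 2 ^ v
          case-p zero     _  = z≤n
          case-p (suc p′) eq = begin
            2 ^ suc p′ * ∑ (suc p′) inner        ≤⟨ *-monoʳ-≤ (2 ^ suc p′) (≤-trans (∑-mono (suc p′) λ Q _ → inner-top Q) (∑-2^∘ p′ top top-inc)) ⟩
            2 ^ suc p′ * 2 ^ suc (top p′)        ≡⟨ sym (^-distribˡ-+-* 2 (suc p′) (suc (top p′))) ⟩
            2 ^ (suc p′ + suc (top p′))          ≡⟨ cong (2 ^_) (alg (top p′) p′) ⟩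
            2 ^ suc (suc (top p′ + p′))          ≤⟨ ^-monoʳ-≤ 2 (below-p p′ eq) ⟩
            2 ^ v                                ∎

        -- Stage p + j has only levels up to v - p - j below X, so the bounds halve from one stage
        -- to the next.
        late : 2 ^ p * ∑ (suc X) (λ j → inner (p + j)) ≤ 2 * 2 ^ suc v
        late = ≤-trans (≤-reflexive (sym (∑-*ˡ (suc X) (2 ^ p) _))) (geometric (suc X) (2 ^ suc v) _ λ j _ → begin
          2 ^ j * (2 ^ p * inner (p + j))    ≡⟨ alg (2 ^ j) (2 ^ p) (inner (p + j)) ⟩
          2 ^ p * 2 ^ j * inner (p + j)      ≡⟨ cong (_* inner (p + j)) (sym (^-distribˡ-+-* 2 p j)) ⟩
          2 ^ (p + j) * inner (p + j)        ≤⟨ inner-size (p + j) ⟩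
          2 ^ suc v                          ∎)
          where
          alg : ∀ a b c → a * (b * c) ≡ b * a * c
          alg = solve-∀

        constant : ℕ
        -- Here 5 is 1 from `early` plus 4 from `late`.
        constant = initial + K * 5

        scaled-count : 2 ^ p * count A? X ≤ constant * 2 ^ v
        scaled-count = begin
          2 ^ p * count A? X
            ≤⟨ *-monoʳ-≤ (2 ^ p) count≤ ⟩
          2 ^ p * (initial + K * ∑ (suc X) inner)
            ≤⟨ *-monoʳ-≤ (2 ^ p) (+-monoʳ-≤ initial (*-monoʳ-≤ K (≤-trans (∑-monoˡ inner (m≤n+m (suc X) p)) (≤-reflexive (∑-split p (suc X) inner))))) ⟩
          2 ^ p * (initial + K * (∑ p inner + ∑ (suc X) (λ j → inner (p + j))))
            ≡⟨ alg₁ (2 ^ p) initial K _ _ ⟩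
          initial * 2 ^ p + K * (2 ^ p * ∑ p inner + 2 ^ p * ∑ (suc X) (λ j → inner (p + j)))
            ≤⟨ +-mono-≤ (*-monoʳ-≤ initial (^-monoʳ-≤ 2 p≤v)) (*-monoʳ-≤ K (+-mono-≤ early late)) ⟩
          initial * 2 ^ v + K * (2 ^ v + 2 * (2 * 2 ^ v))
            ≡⟨ alg₂ initial K (2 ^ v) ⟩
          constant * 2 ^ v ∎
          where
          alg₁ : ∀ p i K s t → p * (i + K * (s + t)) ≡ i * p + K * (p * s + p * t)
          alg₁ = solve-∀
          alg₂ : ∀ i K t → i * t + K * (t + 2 * (2 * t)) ≡ (i + K * 5) * t
          alg₂ = solve-∀

        log-bound : ⌈log₂ X ⌉ ≤ (32 * κ + 6) * height p
        log-bound = begin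
          ⌈log₂ X ⌉                     ≤⟨ ⌈log₂⌉-mono-≤ (<⇒≤ v-upper) ⟩
          ⌈log₂ 2 ^ suc v * 2 ^ suc v ⌉ ≡⟨ trans (cong ⌈log₂_⌉ (sym (^-distribˡ-+-* 2 (suc v) (suc v)))) (⌈log₂2^n⌉≡n (suc v + suc v)) ⟩
          suc v + suc v                 ≤⟨ +-mono-≤ (s≤s reaches) (s≤s reaches) ⟩
          suc (suc (top p + p)) + suc (suc (top p + p)) ≡⟨ alg₁ (top p) p ⟩
          2 * top p + (p + p) + 4       ≤⟨ +-mono-≤ (+-monoʳ-≤ (2 * top p) (≤-trans (2Q≤height p) (m≤m+n _ (height p)))) (*-monoʳ-≤ 4 (height>0 p)) ⟩
          2 * top p + (height p + height p) + 4 * height p ≡⟨ alg₂ κ (height p) ⟩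
          (32 * κ + 6) * height p       ∎
          where
          alg₁ : ∀ t p → suc (suc (t + p)) + suc (suc (t + p)) ≡ 2 * t + (p + p) + 4
          alg₁ = solve-∀
          alg₂ : ∀ κ h → 2 * (16 * κ * h) + (h + h) + 4 * h ≡ (32 * κ + 6) * h
          alg₂ = solve-∀

        -- `height p` is the fourth power of 2^p, so the fourth power of `scaled-count` absorbs the
        -- logarithm.
        bound : count A? X ^ 4 * ⌈log₂ X ⌉ ≤ (constant ^ 4 * (32 * κ + 6)) * X ^ 2
        bound = begin
          f ^ 4 * ⌈log₂ X ⌉                            ≤⟨ *-monoʳ-≤ (f ^ 4) log-bound ⟩
          f ^ 4 * (c * height p)                       ≡⟨ cong (λ t → f ^ 4 * (c * (t * t))) (^-distribˡ-+-* 2 p p) ⟩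
          f ^ 4 * (c * (u * u * (u * u)))              ≡⟨ alg₁ f c u ⟩
          (u * f) ^ 4 * c                              ≤⟨ *-monoˡ-≤ c (^-monoˡ-≤ 4 scaled-count) ⟩
          (constant * 2 ^ v) ^ 4 * c                   ≡⟨ alg₂ constant (2 ^ v) c ⟩
          constant ^ 4 * c * (2 ^ v * 2 ^ v) ^ 2       ≤⟨ *-monoʳ-≤ (constant ^ 4 * c) (^-monoˡ-≤ 2 v-lower) ⟩
          constant ^ 4 * c * X ^ 2                     ∎
          where
          f = count A? X
          c = 32 * κ + 6
          u = 2 ^ p
          alg₁ : ∀ f c u → f * (f * (f * (f * 1))) * (c * (u * u * (u * u))) ≡ u * f * (u * f * (u * f * (u * f * 1))) * c
          alg₁ = solve-∀
          alg₂ : ∀ k u c → k * u * (k * u * (k * u * (k * u * 1))) * c ≡ k * (k * (k * (k * 1))) * c * (u * u * (u * u * 1))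
          alg₂ = solve-∀

  sparse : IsO[√X/[logX]^¼] (count A?)
  sparse = (initial + K * 5) ^ 4 * (32 * κ + 6) , 1 , λ X X>0 →
    let v , lower , upper = log₄ X X>0
        p , reaches , minimal = least (λ p → v ≤? suc (top p + p)) v (≤-trans (m≤n+m v (top v)) (n≤1+n _))
    in bound X v lower upper p reaches minimal

  -- Every number is served by some stage

  Represents : ℕ → ℕ → Set
  Represents Q n = ∃[ a ] ∃[ b ] ∃[ c ] ∃[ d ]
    (∃[ k ] Entry Q k a) × (∃[ k ] Entry Q k b) × (∃[ k ] Entry Q k c) × (∃[ k ] Entry Q k d) × n ≡ a * b + c * d

  module _ (represent : ∀ Q t n → κ * height Q ≤ t → t < top Q → 2 ^ t * 2 ^ t ≤ n → n < 2 ^ suc t * 2 ^ suc t → Represents Q n) where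

    private
      1<initial : 1 < initial
      1<initial = ≤-trans (^-monoʳ-≤ 2 (>-nonZero⁻¹ κ)) (m≤m*n (2 ^ κ) (2 ^ κ) {{2^≢0 {κ}}})

      select : ∀ t → κ ≤ t → ∃[ Q ] κ * height Q ≤ t × t < top Q
      select t κ≤t = choose (least (λ Q → t <? top Q) t (begin-strict
        t                  <⟨ n<2^n t ⟩
        2 ^ t              ≤⟨ ^-monoʳ-≤ 2 (m≤m+n t t) ⟩
        2 ^ (t + t)        ≤⟨ m≤m*n (2 ^ (t + t)) (2 ^ (t + t)) {{2^≢0 {t + t}}} ⟩
        height t           ≤⟨ m≤n*m (height t) (16 * κ) {{m*n≢0 16 κ}} ⟩
        top t              ∎))
        where
        alg : ∀ κ h → κ * (16 * h) ≡ 16 * κ * h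
        alg = solve-∀
        choose : (∃[ Q ] t < top Q × (∀ q → q < Q → ¬ t < top q)) → ∃[ Q ] κ * height Q ≤ t × t < top Q
        choose (zero  , t< , _)  = 0 , ≤-trans (≤-reflexive (*-identityʳ κ)) κ≤t , t<
        choose (suc Q , t< , ¬<) = suc Q ,
          ≤-trans (≤-reflexive (trans (cong (κ *_) (height-suc Q)) (alg κ (height Q)))) (≮⇒≥ (¬< Q ≤-refl)) , t<

    basis : ∀ n → (A ² ⊕ A ²) n
    basis n with n <? initial
    ... | yes n< = n , 0 , (n , 1 , inj₁ n< , inj₁ 1<initial , sym (*-identityʳ n)) ,
                   (0 , 0 , inj₁ 0<initial , inj₁ 0<initial , refl) , sym (+-identityʳ n)
      where
      0<initial : 0 < initial
      0<initial = <⇒≤ 1<initial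
    ... | no n≮ =
      let n≥ = ≮⇒≥ n≮
          t , lower , upper = log₄ n (≤-trans (<⇒≤ 1<initial) n≥)
          Q , κh≤t , t<top = select t (s≤s⁻¹ (2^-cancel-< {κ} {suc t} (sq-cancel-< (≤-trans (s≤s n≥) upper))))
          a , b , c , d , (_ , a∈) , (_ , b∈) , (_ , c∈) , (_ , d∈) , eq = represent Q t n κh≤t t<top lower upper
      in a * b , c * d , (a , b , entry⇒A a∈ , entry⇒A b∈ , refl) , (c , d , entry⇒A c∈ , entry⇒A d∈ , refl) , eq

-- Choice of the parameters

module Construction (w ω θ κ : ℕ) .{{_ : NonZero w}} .{{_ : NonZero κ}}
  (w-divisible : ∀ m → 0 < m → m < 13 → m ∣ w) (2w≤2^ω : 2 * w ≤ 2 ^ ω) (8w≤4^θ : 8 * w ≤ 2 ^ θ * 2 ^ θ)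
  (κ-large : 13 + ω + θ ≤ κ)
  where

  private
    V D : ℕ
    V = 2 ^ θ * 2 ^ θ
    -- A stage handles the 4^(16 κ h) = 2^(32 κ h) numbers below its bound; the extra 1 makes 2^(D
    -- h) strictly larger.
    D = 32 * κ + 1

    few : ∀ Q → 2 ^ (16 * κ * height Q) * 2 ^ (16 * κ * height Q) < 2 ^ (D * height Q)
    few Q = begin-strict
      2 ^ (16 * κ * height Q) * 2 ^ (16 * κ * height Q)  ≡⟨ sym (^-distribˡ-+-* 2 (16 * κ * height Q) _) ⟩
      2 ^ (16 * κ * height Q + 16 * κ * height Q)        <⟨ ^-monoʳ-< 2 ≤-refl (begin-strict
        16 * κ * height Q + 16 * κ * height Q              <⟨ m<m+n _ (height>0 Q) ⟩
        16 * κ * height Q + 16 * κ * height Q + height Q   ≡⟨ alg κ (height Q) ⟩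
        D * height Q                                       ∎) ⟩
      2 ^ (D * height Q)                                 ∎
      where
      open ≤-Reasoning
      alg : ∀ κ h → 16 * κ * h + 16 * κ * h + h ≡ (32 * κ + 1) * h
      alg = solve-∀

    module S (Q : ℕ) = Stage w ω V D (Q + Q) (height Q) (16 * κ * height Q)
      w-divisible 2w≤2^ω 8w≤4^θ refl (2Q≤height Q) (few Q)

  open Assemble κ (3 + 16 * V * D) S.level (λ Q k → ≤-reflexive (S.length-level Q k)) public

  private
    represent : ∀ Q t n → κ * height Q ≤ t → t < top Q → 2 ^ t * 2 ^ t ≤ n → n < 2 ^ suc t * 2 ^ suc t → Represents Q n
    represent Q t n κh≤t t<top lower upper =
      S.represent Q s n s-large (≤-trans (s≤s (m∸n≤m t (θ + (Q + Q)))) t<top)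
        (≤-trans (≤-reflexive scale) lower)
        (≤-trans upper (≤-reflexive (trans (alg₁ (2 ^ t)) (trans (cong (4 *_) (sym scale)) (sym (*-assoc 4 V _))))))
        (≤-trans upper (sq-mono-≤ (^-monoʳ-≤ 2 t<top)))
      where
      h = height Q
      -- With this s, V T^2 F^2 is exactly 4^t, so the window of s is 4^t ≤ n < 4^(t + 1).
      s = t ∸ (θ + (Q + Q))
      alg₁ : ∀ u → 2 * u * (2 * u) ≡ 4 * (u * u)
      alg₁ = solve-∀
      alg₂ : ∀ a b c → a * a * (b * b * (c * c)) ≡ b * (a * c) * (b * (a * c))
      alg₂ = solve-∀
      alg₃ : ∀ ω θ h → 6 * h + 6 + ω + (θ + h) ≡ 7 * h + (6 + ω + θ)
      alg₃ = solve-∀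
      alg₄ : ∀ ω θ h → 7 * h + (6 + ω + θ) * h ≡ (13 + ω + θ) * h
      alg₄ = solve-∀
      -- Source of `13 + ω + θ`: 6h plus Q + Q ≤ h gives 7h, and h ≥ 1 lets the constant 6 + ω + θ
      -- be multiplied by h.
      room : 6 * h + 6 + ω + (θ + (Q + Q)) ≤ t
      room = begin
        6 * h + 6 + ω + (θ + (Q + Q))      ≤⟨ +-monoʳ-≤ (6 * h + 6 + ω) (+-monoʳ-≤ θ (2Q≤height Q)) ⟩
        6 * h + 6 + ω + (θ + h)            ≡⟨ alg₃ ω θ h ⟩
        7 * h + (6 + ω + θ)                ≤⟨ +-monoʳ-≤ (7 * h) (m≤m*n (6 + ω + θ) h {{>-nonZero (height>0 Q)}}) ⟩
        7 * h + (6 + ω + θ) * h            ≡⟨ alg₄ ω θ h ⟩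
        (13 + ω + θ) * h                   ≤⟨ *-monoˡ-≤ h κ-large ⟩
        κ * h                              ≤⟨ κh≤t ⟩
        t                                  ∎
        where open ≤-Reasoning
      s-large : 6 * h + 6 + ω ≤ s
      s-large = m+n≤o⇒m≤o∸n (6 * h + 6 + ω) room
      scale : V * (2 ^ s * 2 ^ s * (2 ^ (Q + Q) * 2 ^ (Q + Q))) ≡ 2 ^ t * 2 ^ t
      scale = trans (alg₂ (2 ^ θ) (2 ^ s) (2 ^ (Q + Q))) (cong (λ u → u * u)
        (trans (cong (2 ^ s *_) (sym (^-distribˡ-+-* 2 θ (Q + Q))))
          (trans (sym (^-distribˡ-+-* 2 s (θ + (Q + Q)))) (cong (2 ^_) (m∸n+n≡m (m+n≤o⇒n≤o (6 * h + 6 + ω) room))))))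

  squares-basis : ∀ n → (A ² ⊕ A ²) n
  squares-basis = basis represent

theorem1p4 : Σ[ A ∈ Pred ℕ 0ℓ ] Σ[ A? ∈ Decidable A ]
    ((A ² ⊕ A ²) ≐ U) × IsO[√X/[logX]^¼] (count A?)
-- 27720 = lcm(1, …, 12)
theorem1p4 = C.A , C.A? , ((λ _ → tt) , λ {n} _ → C.squares-basis n) , C.sparse
  where
  -- 16 and 9 are the least exponents with 2 · 27720 ≤ 2^16 and 8 · 27720 ≤ 4^9, and 38 = 13 + 16 +
  -- 9.
  module C = Construction 27720 16 9 38
    (λ m 0<m m<13 → toWitness {a? = allUpTo? (λ m → (0 <? m) →-dec (m ∣? 27720)) 13} tt m<13 0<m)
    (≤ᵇ⇒≤ _ _ tt) (≤ᵇ⇒≤ _ _ tt) ≤-refl
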